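{- Let $P\subset\mathbb R^2$ be a convex lattice polygon with nonzero area $A(P)$, and let $l=\operatorname{ls}_\Delta(P)$. Then $A(P)\ge \frac12 l$. Equality holds exactly when $P$ is lattice-equivalent to one of: (a) $\operatorname{conv}\{(0,0),(l,0),(0,1)\}$ (for $l\ge1$); (b) $[0,1]^2$ (when $l=2$); (c) $\operatorname{conv}\{(0,0),(1,2),(2,1)\}$ (when $l=3$).
   Context: A lattice polygon is a convex polygon all of whose vertices lie in $\mathbb Z^2$. An affine unimodular transformation is $x\mapsto Ax+v$ with $A\in\mathbb Z^{2\times2}$, $\det A=\pm1$, $v\in\mathbb Z^2$; two sets are lattice-equivalent if one is the image of the other under such a map. With $\Delta=\operatorname{conv}\{(0,0),(1,0),(0,1)\}$, $\operatorname{ls}_\Delta(P)$ is the smallest $l\ge0$ such that $\varphi(P)\subseteq l\Delta$ for some affine unimodular $\varphi$. -}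

module Defs where

open import Level using (0ℓ)
open import Data.Fin.Base using (Fin; _<_)
open import Data.Integer.Base as ℤ using (ℤ; +_; 0ℤ; 1ℤ; -1ℤ)
open import Data.List.Base using (List; []; _∷_; length; lookup; map)
open import Data.List.Relation.Unary.Unique.Propositional using (Unique)
open import Data.Product.Base using (_×_; _,_; Σ-syntax; ∃-syntax; proj₁; proj₂)
open import Data.Rational.Base as ℚ using (ℚ; 0ℚ; 1ℚ; ½)
open import Data.Rational.Literals using (fromℤ)
open import Data.Rational.Properties using (+-0-commutativeMonoid)
open import Data.Sum.Base using (_⊎_)
open import Relation.Binary.PropositionalEquality.Core using (_≡_)
open import Relation.Unary using (Pred; _⊆_; _≐_)
open import Algebra.Properties.CommutativeMonoid.Sum +-0-commutativeMonoid using (sum)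

-- The plane is represented by its rational points.  All sets below are convex
-- hulls of finitely many rational points, so nothing is lost: such hulls over ℝ
-- are equal, or included in one another, iff their sets of rational points are.

ℤ² : Set
ℤ² = ℤ × ℤ

ℚ² : Set
ℚ² = ℚ × ℚ

Region : Set₁
Region = Pred ℚ² 0ℓ

fromℤ² : ℤ² → ℚ²
fromℤ² (x , y) = fromℤ x , fromℤ y

conv : List ℚ² → Region
conv ps x = Σ[ w ∈ (Fin (length ps) → ℚ) ]
  (∀ i → 0ℚ ℚ.≤ w i) ×
  sum w ≡ 1ℚ ×
  sum (λ i → w i ℚ.* proj₁ (lookup ps i)) ≡ proj₁ x ×
  sum (λ i → w i ℚ.* proj₂ (lookup ps i)) ≡ proj₂ x

image : (ℚ² → ℚ²) → Region → Region
image f S y = ∃[ x ] (S x × f x ≡ y)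

cross : ℤ² → ℤ² → ℤ
cross (a , b) (c , d) = a ℤ.* d ℤ.- b ℤ.* c

_-²_ : ℤ² → ℤ² → ℤ²
(a , b) -² (c , d) = (a ℤ.- c) , (b ℤ.- d)

-- A convex polygon is given by its vertices in counterclockwise order: every
-- triple of vertices, taken in the order of the list, makes a strict left turn.
-- With at least three vertices this says that they are in strictly convex
-- position and listed once around the boundary.  Shorter lists give the
-- degenerate polygons (segments, points, the empty set), which have area zero.

record LatticePolygon : Set where
  field
    vertices : List ℤ²
    distinct : Unique vertices
    ccw      : ∀ {i j k : Fin (length vertices)} → i < j → j < k →
               0ℤ ℤ.< cross (lookup vertices j -² lookup vertices i)
                            (lookup vertices k -² lookup vertices i)

  region : Region
  region = conv (map fromℤ² vertices)

open LatticePolygon public using (region)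

-- `shoelace o (p₁ ∷ … ∷ pₙ ∷ [])` is the sum of the cross products of consecutive
-- points of the closed-up sequence p₁, …, pₙ, o.
shoelace : ℤ² → List ℤ² → ℤ
shoelace o []           = 0ℤ
shoelace o (p ∷ [])     = cross p o
shoelace o (p ∷ q ∷ ps) = cross p q ℤ.+ shoelace o (q ∷ ps)

-- Twice the signed area enclosed by the closed polygonal path through the points.
twiceArea : List ℤ² → ℤ
twiceArea []       = 0ℤ
twiceArea (p ∷ ps) = shoelace p (p ∷ ps)

-- The counterclockwise order of the vertices makes this nonnegative.
area : LatticePolygon → ℚ
area P = ½ ℚ.* fromℤ (twiceArea (LatticePolygon.vertices P))

-- x ↦ A x + v with A = (a b ; c d) and v = (e , f).
record AffineUnimodular : Set where
  field
    a b c d : ℤ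
    e f     : ℤ
    det≡±1  : (a ℤ.* d ℤ.- b ℤ.* c ≡ 1ℤ) ⊎ (a ℤ.* d ℤ.- b ℤ.* c ≡ -1ℤ)

  apply : ℚ² → ℚ²
  apply (x , y) =
    (fromℤ a ℚ.* x ℚ.+ fromℤ b ℚ.* y ℚ.+ fromℤ e) ,
    (fromℤ c ℚ.* x ℚ.+ fromℤ d ℚ.* y ℚ.+ fromℤ f)

open AffineUnimodular public using (apply)

infix 4 _≃ₗ_

_≃ₗ_ : Region → Region → Set
S ≃ₗ T = ∃[ φ ] (image (apply φ) S ≐ T)

Δ : Region
Δ = conv ((0ℚ , 0ℚ) ∷ (1ℚ , 0ℚ) ∷ (0ℚ , 1ℚ) ∷ [])

infixr 7 _·_

_·_ : ℚ → Region → Region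
l · S = image (λ x → l ℚ.* proj₁ x , l ℚ.* proj₂ x) S

FitsIn : Region → Region → Set
FitsIn S T = ∃[ φ ] (image (apply φ) S ⊆ T)

-- l = ls_Δ(S).  For lattice polygons the minimum over real l is an integer, so
-- letting l range over the rationals gives the same value.
record IsLsΔ (S : Region) (l : ℚ) : Set where
  field
    nonneg  : 0ℚ ℚ.≤ l
    fits    : FitsIn S (l · Δ)
    minimal : ∀ l′ → 0ℚ ℚ.≤ l′ → FitsIn S (l′ · Δ) → l ℚ.≤ l′

2ℚ 3ℚ : ℚ
2ℚ = fromℤ (+ 2)
3ℚ = fromℤ (+ 3)

thinTriangle : ℚ → Region
thinTriangle l = conv ((0ℚ , 0ℚ) ∷ (l , 0ℚ) ∷ (0ℚ , 1ℚ) ∷ [])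

unitSquare : Region
unitSquare (x , y) = (0ℚ ℚ.≤ x × x ℚ.≤ 1ℚ) × (0ℚ ℚ.≤ y × y ℚ.≤ 1ℚ)

triangle₁₂ : Region
triangle₁₂ = conv ((0ℚ , 0ℚ) ∷ (1ℚ , 2ℚ) ∷ (2ℚ , 1ℚ) ∷ [])

{-# OPTIONS --safe #-}
module Submission where

-- Let D be twice the area.  For four vertices p, q, r, s the cross product of q - p and s - r is at
-- most twice the area of the quadrilateral they span, hence at most D; the lower bound needs no more
-- than this.  Take a basis in which the widths w of y and X of x satisfy w ≤ X ≤ width (x ± y), and
-- let Y be the width of x + y.  The smallest dilates of Δ around the polygon in the coordinates
-- (x , y) and (-x , -y) have sizes with sum X + Y + w.  Combining the cross products of three pairs,
-- the extreme points of x, of x + y and of y, gives w (X + Y - w) ≤ 2 D.  Hence one of the two sizes is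
-- less than D, except when w = 1 or (X , Y , w) is (2 , 2 , 2) or (2 , 4 , 2), where explicit coordinates
-- decide.  Conversely, the vertices of a lattice polygon inside an exceptional region are among the
-- few lattice points of that region.

open import Defs
open import Data.Fin.Base as Fin using (Fin; zero; suc)
open import Data.Fin.Patterns using (0F; 1F; 2F; 3F; 4F)
import Data.Fin.Properties as Finₚ
open import Data.List.Base using (List; []; _∷_; length; lookup; map)
open import Data.List.Membership.Propositional using (_∈_)
open import Data.List.Membership.Propositional.Properties using (∈-map⁺; ∈-lookup)
open import Data.List.Properties using (tabulate-lookup)
open import Data.List.Relation.Unary.All as All using (All; []; _∷_; all?)
open import Data.List.Relation.Unary.AllPairs using (AllPairs; []; _∷_)
import Data.List.Relation.Unary.AllPairs.Properties as AllPairs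
open import Data.List.Relation.Unary.Any using (here; there)
open import Data.Nat.Base as ℕ using (ℕ; zero; suc; z<s; s<s)
import Data.Nat.Properties as ℕₚ
open import Data.Product.Base using (_×_; _,_; ∃-syntax; proj₁; proj₂)
open import Data.Rational.Literals using (fromℤ)
open import Data.Sum.Base using (_⊎_; inj₁; inj₂; [_,_]′)
open import Function.Bundles using (_⇔_; mk⇔)
open import Level using (0ℓ)
open import Relation.Binary.PropositionalEquality using (_≡_; _≢_; refl; sym; trans; cong; cong₂; subst; subst₂)
open import Relation.Nullary using (¬_; yes; no; contradiction)
open import Relation.Nullary.Decidable using (dec⇒maybe; from-yes; from-no; _⊎-dec_)
open import Relation.Unary using (_⊆_)

-- The triangles Δ and -Δ have the same edge directions. The smallest dilate of each around the set
-- is determined by supporting lines in these directions, and opposite supporting lines differ by a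
-- width; hence the sum X + Y + w. If this sum is below 2 D, one of the sizes is below D. For w ≥ 3
-- the bound w (X + Y - w) ≤ 2 D implies this, with the help of integrality when X = Y = w = 3. So
-- widths 1 and 2 are the delicate ones, and for width 2 the slopes of the extreme chords have to be
-- taken into account.
--
-- The argument runs on a finite indexed family of lattice points, and all it asks of D is that no
-- cross product of two differences exceeds D. As all quadruples of indices are allowed, this
-- survives every affine unimodular map, orientation-reversing ones included, so the basis can be
-- changed freely. Convex position is used to show that twice the area has this property, and again
-- in the converse. The exceptional outcomes record indices of points attaining the corners; these
-- turn an inclusion of regions into an equality.

module Lattice where

  open import Data.Integer.Base hiding (suc)
  open import Data.Integer.Properties
  open import Data.Integer.Tactic.RingSolver using (solve-∀)

  -- Nonnegativity certificates over the integers

  infixl 6 _⊕_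
  infixl 7 _⊗_

  _⊕_ : ∀ {a b} → 0ℤ ≤ a → 0ℤ ≤ b → 0ℤ ≤ a + b
  _⊕_ = +-mono-≤

  _⊗_ : ∀ {a b} → 0ℤ ≤ a → 0ℤ ≤ b → 0ℤ ≤ a * b
  _⊗_ {a} {b} p q = subst (_≤ a * b) (*-zeroʳ a) (*-monoˡ-≤-nonNeg a {{nonNegative p}} q)

  gap : ∀ {a b} → a ≤ b → 0ℤ ≤ b - a
  gap = i≤j⇒0≤j-i

  -- The standard form of the estimates below: the gap b - a is written as a combination of
  -- quantities known to be nonnegative, and the ring solver checks the identity.
  certify : ∀ {a b e} → 0ℤ ≤ e → e ≡ b - a → a ≤ b
  certify p eq = 0≤i-j⇒j≤i (subst (0ℤ ≤_) eq p)

  nat : ∀ {n} → 0ℤ ≤ + n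
  nat = +≤+ ℕ.z≤n

  ≤-split : ∀ {a b} → a ≤ b → a ≡ b ⊎ + 1 + a ≤ b
  ≤-split {a} {b} p with a ≟ b
  ... | yes e = inj₁ e
  ... | no ne = inj₂ (i<j⇒suc[i]≤j (≤∧≢⇒< p ne))

  ≤-or-> : ∀ a b → a ≤ b ⊎ + 1 + b ≤ a
  ≤-or-> a b with a ≤? b
  ... | yes p = inj₁ p
  ... | no np = inj₂ (i<j⇒suc[i]≤j (≰⇒> np))

  -- Integer points under affine unimodular maps

  applyℤ : AffineUnimodular → ℤ² → ℤ²
  applyℤ φ (x , y) = (a * x + b * y + e) , (c * x + d * y + f)
    where open AffineUnimodular φ

  det : AffineUnimodular → ℤ
  det φ = a * d - b * c
    where open AffineUnimodular φ

  infixr 9 _∘ₗ_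

  _∘ₗ_ : AffineUnimodular → AffineUnimodular → AffineUnimodular
  φ ∘ₗ ψ = record
    { a = φ.a * ψ.a + φ.b * ψ.c ; b = φ.a * ψ.b + φ.b * ψ.d
    ; c = φ.c * ψ.a + φ.d * ψ.c ; d = φ.c * ψ.b + φ.d * ψ.d
    ; e = φ.a * ψ.e + φ.b * ψ.f + φ.e ; f = φ.c * ψ.e + φ.d * ψ.f + φ.f
    ; det≡±1 = unit (det-∘ φ.a φ.b φ.c φ.d ψ.a ψ.b ψ.c ψ.d) φ.det≡±1 ψ.det≡±1 }
    where
    module φ = AffineUnimodular φ
    module ψ = AffineUnimodular ψ
    det-∘ : ∀ a b c d a′ b′ c′ d′ →
      (a * a′ + b * c′) * (c * b′ + d * d′) - (a * b′ + b * d′) * (c * a′ + d * c′)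
        ≡ (a * d - b * c) * (a′ * d′ - b′ * c′)
    det-∘ = solve-∀
    unit : ∀ {p q r} → r ≡ p * q → p ≡ 1ℤ ⊎ p ≡ -1ℤ → q ≡ 1ℤ ⊎ q ≡ -1ℤ → r ≡ 1ℤ ⊎ r ≡ -1ℤ
    unit eq (inj₁ u) (inj₁ v) = inj₁ (trans eq (cong₂ _*_ u v))
    unit eq (inj₁ u) (inj₂ v) = inj₂ (trans eq (cong₂ _*_ u v))
    unit eq (inj₂ u) (inj₁ v) = inj₂ (trans eq (cong₂ _*_ u v))
    unit eq (inj₂ u) (inj₂ v) = inj₁ (trans eq (cong₂ _*_ u v))

  apply-∘ₗ : ∀ φ ψ v → applyℤ (φ ∘ₗ ψ) v ≡ applyℤ φ (applyℤ ψ v)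
  apply-∘ₗ φ ψ (x , y) = cong₂ _,_ (row φ.a φ.b φ.e ψ.a ψ.b ψ.c ψ.d ψ.e ψ.f x y)
                                   (row φ.c φ.d φ.f ψ.a ψ.b ψ.c ψ.d ψ.e ψ.f x y)
    where
    module φ = AffineUnimodular φ
    module ψ = AffineUnimodular ψ
    row : ∀ a b e a′ b′ c′ d′ e′ f′ x y →
      (a * a′ + b * c′) * x + (a * b′ + b * d′) * y + (a * e′ + b * f′ + e)
        ≡ a * (a′ * x + b′ * y + e′) + b * (c′ * x + d′ * y + f′) + e
    row = solve-∀

  cross-apply : ∀ φ p q r s →
    cross (applyℤ φ q -² applyℤ φ p) (applyℤ φ s -² applyℤ φ r) ≡ det φ * cross (q -² p) (s -² r)
  cross-apply φ (px , py) (qx , qy) (rx , ry) (sx , sy) = go a b c d e f px py qx qy rx ry sx sy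
    where
    open AffineUnimodular φ
    go : ∀ a b c d e f px py qx qy rx ry sx sy →
      ((a * qx + b * qy + e) - (a * px + b * py + e)) * ((c * sx + d * sy + f) - (c * rx + d * ry + f))
      - ((c * qx + d * qy + f) - (c * px + d * py + f)) * ((a * sx + b * sy + e) - (a * rx + b * ry + e))
      ≡ (a * d - b * c) * ((qx - px) * (sy - ry) - (qy - py) * (sx - rx))
    go = solve-∀

  cross-flip : ∀ p q r s → cross (q -² p) (s -² r) ≡ -1ℤ * cross (q -² p) (r -² s)
  cross-flip (px , py) (qx , qy) (rx , ry) (sx , sy) = go px py qx qy rx ry sx sy
    where
    go : ∀ px py qx qy rx ry sx sy →
      (qx - px) * (sy - ry) - (qy - py) * (sx - rx)
        ≡ -1ℤ * ((qx - px) * (ry - sy) - (qy - py) * (rx - sx))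
    go = solve-∀


  -- Families of lattice points and the possible outcomes

  private variable
    n : ℕ

  Points : ℕ → Set
  Points n = Fin n → ℤ²

  -- Up to sign, the cross product is twice the area of a quadrilateral with diagonals pq and rs.
  Bound : Points n → ℤ → Set
  Bound V D = ∀ p q r s → cross (V q -² V p) (V s -² V r) ≤ D

  Collinear : Points n → Set
  Collinear V = ∀ p q r s → cross (V q -² V p) (V s -² V r) ≡ 0ℤ

  infix 4 _⟶[_]_

  _⟶[_]_ : Points n → AffineUnimodular → Points n → Set
  V ⟶[ ψ ] W = ∀ i → applyℤ ψ (V i) ≡ W i

  -- A map of determinant -1 negates every cross product, and exchanging `r` and `s` negates it
  -- back; a one-sided bound over all quadruples is therefore invariant.
  bound-along : ∀ {V W : Points n} {D} ψ → V ⟶[ ψ ] W → Bound V D → Bound W D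
  bound-along {V = V} {W} {D} ψ eq bd p q r s = subst (_≤ D) (cong₂ cross (cong₂ _-²_ (eq q) (eq p)) (cong₂ _-²_ (eq s) (eq r)))
    (subst (_≤ D) (sym (cross-apply ψ (V p) (V q) (V r) (V s))) (go (AffineUnimodular.det≡±1 ψ)))
    where
    k = cross (V q -² V p) (V s -² V r)
    go : det ψ ≡ 1ℤ ⊎ det ψ ≡ -1ℤ → det ψ * k ≤ D
    go (inj₁ u) rewrite u | *-identityˡ k = bd p q r s
    go (inj₂ u) rewrite u = subst (_≤ D) (cross-flip (V p) (V q) (V s) (V r)) (bd p q s r)

  collinear-along : ∀ {V W : Points n} ψ → V ⟶[ ψ ] W → Collinear W → Collinear V
  collinear-along {V = V} {W} ψ eq col p q r s = go (AffineUnimodular.det≡±1 ψ)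
    (trans (sym (cross-apply ψ (V p) (V q) (V r) (V s)))
      (trans (cong₂ cross (cong₂ _-²_ (eq q) (eq p)) (cong₂ _-²_ (eq s) (eq r))) (col p q r s)))
    where
    k = cross (V q -² V p) (V s -² V r)
    go : det ψ ≡ 1ℤ ⊎ det ψ ≡ -1ℤ → det ψ * k ≡ 0ℤ → k ≡ 0ℤ
    go (inj₁ u) h rewrite u = trans (sym (*-identityˡ k)) h
    go (inj₂ u) h rewrite u = *-cancelˡ-≡ -1ℤ k 0ℤ h

  InTriangle : ℤ → ℤ → ℤ² → Set
  InTriangle k l (x , y) = 0ℤ ≤ x × 0ℤ ≤ y × x + k * y ≤ l

  InSquare : ℤ² → Set
  InSquare (x , y) = (0ℤ ≤ x × x ≤ 1ℤ) × (0ℤ ≤ y × y ≤ 1ℤ)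

  InTriangle₁₂ : ℤ² → Set
  InTriangle₁₂ (x , y) = x ≤ + 2 * y × y ≤ + 2 * x × x + y ≤ + 3

  -- The indices in the last three constructors name points attaining the corners, so that the hull
  -- fills the exceptional region. In `smaller`, the condition `+ 2 ≤ D` keeps the dilation factor D
  -- - 1 positive.
  data Outcome (V : Points n) (D : ℤ) : Set where
    smaller  : ∀ φ → + 2 ≤ D → (∀ i → InTriangle 1ℤ (D - 1ℤ) (applyℤ φ (V i))) → Outcome V D
    thin     : ∀ φ → + 1 ≤ D → (∀ i → InTriangle D D (applyℤ φ (V i))) →
               ∀ o p q → applyℤ φ (V o) ≡ (0ℤ , 0ℤ) → applyℤ φ (V p) ≡ (D , 0ℤ) →
               applyℤ φ (V q) ≡ (0ℤ , 1ℤ) → Outcome V D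
    square   : ∀ φ → D ≡ + 2 → (∀ i → InSquare (applyℤ φ (V i))) →
               ∀ o p q r → applyℤ φ (V o) ≡ (0ℤ , 0ℤ) → applyℤ φ (V p) ≡ (1ℤ , 0ℤ) →
               applyℤ φ (V q) ≡ (0ℤ , 1ℤ) → applyℤ φ (V r) ≡ (1ℤ , 1ℤ) → Outcome V D
    triangle : ∀ φ → D ≡ + 3 → (∀ i → InTriangle₁₂ (applyℤ φ (V i))) →
               ∀ o p q → applyℤ φ (V o) ≡ (0ℤ , 0ℤ) → applyℤ φ (V p) ≡ (1ℤ , + 2) →
               applyℤ φ (V q) ≡ (+ 2 , 1ℤ) → Outcome V D

  outcome-along : ∀ {V W : Points n} {D} ψ → V ⟶[ ψ ] W → Outcome W D → Outcome V D
  outcome-along {V = V} {W} ψ eq = go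
    where
    via : ∀ φ i → applyℤ φ (W i) ≡ applyℤ (φ ∘ₗ ψ) (V i)
    via φ i = trans (cong (applyℤ φ) (sym (eq i))) (sym (apply-∘ₗ φ ψ (V i)))
    all : ∀ (P : ℤ² → Set) φ → (∀ i → P (applyℤ φ (W i))) → ∀ i → P (applyℤ (φ ∘ₗ ψ) (V i))
    all P φ h i = subst P (via φ i) (h i)
    at : ∀ φ i {v} → applyℤ φ (W i) ≡ v → applyℤ (φ ∘ₗ ψ) (V i) ≡ v
    at φ i h = trans (sym (via φ i)) h
    go : ∀ {D} → Outcome W D → Outcome V D
    go {D} (smaller φ D≥2 h) = smaller (φ ∘ₗ ψ) D≥2 (all (InTriangle 1ℤ (D - 1ℤ)) φ h)
    go {D} (thin φ D≥1 h o p q ho hp hq) =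
      thin (φ ∘ₗ ψ) D≥1 (all (InTriangle D D) φ h) o p q (at φ o ho) (at φ p hp) (at φ q hq)
    go (square φ D≡2 h o p q r ho hp hq hr) =
      square (φ ∘ₗ ψ) D≡2 (all InSquare φ h) o p q r (at φ o ho) (at φ p hp) (at φ q hq) (at φ r hr)
    go (triangle φ D≡3 h o p q ho hp hq) =
      triangle (φ ∘ₗ ψ) D≡3 (all InTriangle₁₂ φ h) o p q (at φ o ho) (at φ p hp) (at φ q hq)

  Claim : Points n → ℤ → Set
  Claim V D = Bound V D → ¬ Collinear V → Outcome V D

  claim-along : ∀ {V W : Points n} {D} ψ → V ⟶[ ψ ] W → Claim W D → Claim V D
  claim-along ψ eq claim bd nc = outcome-along ψ eq (claim (bound-along ψ eq bd) (λ col → nc (collinear-along ψ eq col)))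

  bound-at : ∀ (V : Points n) {D} {P Q R S} → Bound V D → ∀ {p q r s} →
    V p ≡ P → V q ≡ Q → V r ≡ R → V s ≡ S → cross (Q -² P) (S -² R) ≤ D
  bound-at V bd refl refl refl refl = bd _ _ _ _

  -- Extreme values of a function on a finite set

  record Range (f : Fin n → ℤ) : Set where
    field
      lo hi : Fin n
      lo≤   : ∀ i → f lo ≤ f i
      ≤hi   : ∀ i → f i ≤ f hi

    width : ℤ
    width = f hi - f lo

    0≤width : 0ℤ ≤ width
    0≤width = gap (lo≤ hi)


  open Range

  minimiser : (f : Fin (suc n) → ℤ) → ∃[ j ] (∀ i → f j ≤ f i)
  minimiser {zero}  f = zero , λ { zero → ≤-refl }
  minimiser {suc n} f with minimiser (λ i → f (suc i))
  ... | j , h with ≤-total (f zero) (f (suc j))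
  ...   | inj₁ p = zero  , λ { zero → ≤-refl ; (suc i) → ≤-trans p (h i) }
  ...   | inj₂ p = suc j , λ { zero → p ; (suc i) → h i }

  range : (f : Fin (suc n) → ℤ) → Range f
  range f with minimiser f | minimiser (λ i → - f i)
  ... | l , hl | h , hh = record { lo = l ; hi = h ; lo≤ = hl ; ≤hi = λ i → neg-cancel-≤ (hh i) }

  range-neg : ∀ {f : Fin n → ℤ} → Range f → Range (λ i → - f i)
  range-neg r = record { lo = hi r ; hi = lo r ; lo≤ = λ i → neg-mono-≤ (≤hi r i) ; ≤hi = λ i → neg-mono-≤ (lo≤ r i) }

  range-cong : ∀ {f g : Fin n → ℤ} → (∀ i → f i ≡ g i) → Range f → Range g
  range-cong eq r = record
    { lo = lo r ; hi = hi r
    ; lo≤ = λ i → subst₂ _≤_ (eq (lo r)) (eq i) (lo≤ r i)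
    ; ≤hi = λ i → subst₂ _≤_ (eq i) (eq (hi r)) (≤hi r i) }

  translate : ℤ → ℤ → AffineUnimodular
  translate u v = record { a = 1ℤ ; b = 0ℤ ; c = 0ℤ ; d = 1ℤ ; e = - u ; f = - v ; det≡±1 = inj₁ refl }

  translate-apply : ∀ u v x y → applyℤ (translate u v) (x , y) ≡ (x - u , y - v)
  translate-apply u v x y = cong₂ _,_ (go₁ u x y) (go₂ v x y)
    where
    go₁ : ∀ u x y → 1ℤ * x + 0ℤ * y + - u ≡ x - u
    go₁ = solve-∀
    go₂ : ∀ v x y → 0ℤ * x + 1ℤ * y + - v ≡ y - v
    go₂ = solve-∀

  rotate : ℤ → ℤ → AffineUnimodular
  rotate u v = record { a = -1ℤ ; b = 0ℤ ; c = 0ℤ ; d = -1ℤ ; e = u ; f = v ; det≡±1 = inj₁ refl }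

  rotate-apply : ∀ u v x y → applyℤ (rotate u v) (x , y) ≡ (u - x , v - y)
  rotate-apply u v x y = cong₂ _,_ (go₁ u x y) (go₂ v x y)
    where
    go₁ : ∀ u x y → -1ℤ * x + 0ℤ * y + u ≡ u - x
    go₁ = solve-∀
    go₂ : ∀ v x y → 0ℤ * x + -1ℤ * y + v ≡ v - y
    go₂ = solve-∀

  flipʸ : ℤ → AffineUnimodular
  flipʸ v = record { a = 1ℤ ; b = 0ℤ ; c = 0ℤ ; d = -1ℤ ; e = 0ℤ ; f = v ; det≡±1 = inj₂ refl }

  flipʸ-apply : ∀ v x y → applyℤ (flipʸ v) (x , y) ≡ (x , v - y)
  flipʸ-apply v x y = cong₂ _,_ (go₁ x y) (go₂ v x y)
    where
    go₁ : ∀ x y → 1ℤ * x + 0ℤ * y + 0ℤ ≡ x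
    go₁ = solve-∀
    go₂ : ∀ v x y → 0ℤ * x + -1ℤ * y + v ≡ v - y
    go₂ = solve-∀

  swapˣʸ : AffineUnimodular
  swapˣʸ = record { a = 0ℤ ; b = 1ℤ ; c = 1ℤ ; d = 0ℤ ; e = 0ℤ ; f = 0ℤ ; det≡±1 = inj₂ refl }

  swapˣʸ-apply : ∀ x y → applyℤ swapˣʸ (x , y) ≡ (y , x)
  swapˣʸ-apply x y = cong₂ _,_ (go₁ x y) (go₂ x y)
    where
    go₁ : ∀ x y → 0ℤ * x + 1ℤ * y + 0ℤ ≡ y
    go₁ = solve-∀
    go₂ : ∀ x y → 1ℤ * x + 0ℤ * y + 0ℤ ≡ x
    go₂ = solve-∀

  shear : ℤ → ℤ → AffineUnimodular
  shear k u = record { a = 1ℤ ; b = k ; c = 0ℤ ; d = 1ℤ ; e = u ; f = 0ℤ ; det≡±1 = inj₁ (det-shear k) }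
    where
    det-shear : ∀ k → 1ℤ * 1ℤ - k * 0ℤ ≡ 1ℤ
    det-shear = solve-∀

  shear-apply : ∀ k u x y → applyℤ (shear k u) (x , y) ≡ (x + k * y + u , y)
  shear-apply k u x y = cong₂ _,_ (go₁ k u x y) (go₂ x y)
    where
    go₁ : ∀ k u x y → 1ℤ * x + k * y + u ≡ x + k * y + u
    go₁ = solve-∀
    go₂ : ∀ x y → 0ℤ * x + 1ℤ * y + 0ℤ ≡ y
    go₂ = solve-∀

  smaller-along : ∀ {V W : Points n} {D} ψ → V ⟶[ ψ ] W → + 2 ≤ D →
    (∀ i → InTriangle 1ℤ (D - 1ℤ) (W i)) → Outcome V D
  smaller-along {D = D} ψ eq D≥2 h =
    smaller ψ D≥2 (λ i → subst (InTriangle 1ℤ (D - 1ℤ)) (sym (eq i)) (h i))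

  -- Width one

  OnRow : ℤ → ℤ → ℤ → ℤ² → Set
  OnRow c l h (x , y) = y ≡ c × l ≤ x × x ≤ h

  -- The set lies in the dilate of Δ of size max (a , b + 1), and the diagonals give a + b ≤ D. So
  -- size D - 1 suffices unless a = D and b = 0 (thin triangle), or a = b = 1 and D = 2 (square).
  wide-trapezoid : ∀ {V : Points n} {D a b p q r s} → 0ℤ ≤ b → b ≤ a →
    V p ≡ (0ℤ , 0ℤ) → V q ≡ (a , 0ℤ) → V r ≡ (0ℤ , 1ℤ) → V s ≡ (b , 1ℤ) →
    (∀ i → OnRow 0ℤ 0ℤ a (V i) ⊎ OnRow 1ℤ 0ℤ b (V i)) → Claim V D
  wide-trapezoid {V = V} {D} {a} {b} {p} {q} {r} {s} 0≤b b≤a Vp Vq Vr Vs rows bd nc = main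
    where
    ι : AffineUnimodular
    ι = translate 0ℤ 0ℤ

    ι-id : ∀ v → applyℤ ι v ≡ v
    ι-id (x , y) = trans (translate-apply 0ℤ 0ℤ x y) (cong₂ _,_ (+-identityʳ x) (+-identityʳ y))

    at : ∀ {j v} → V j ≡ v → applyℤ ι (V j) ≡ v
    at {j} h = trans (ι-id (V j)) h

    all : ∀ {P : ℤ² → Set} → (∀ i → P (V i)) → ∀ i → P (applyℤ ι (V i))
    all {P} h i = subst P (sym (ι-id (V i))) (h i)

    a+b≤D : a + b ≤ D
    -- The diagonals run from (0 , 1) to (a , 0) and from (0 , 0) to (b , 1).
    a+b≤D = subst (_≤ D) (go a b) (bound-at V bd Vr Vq Vp Vs)
      where
      go : ∀ a b → (a - 0ℤ) * (1ℤ - 0ℤ) - (0ℤ - 1ℤ) * (b - 0ℤ) ≡ a + b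
      go = solve-∀

    1≤a : + 1 ≤ a
    1≤a with ≤-split (≤-trans 0≤b b≤a)
    ... | inj₂ h = h
    -- For a = 0 both rows shrink to the line x = 0.
    ... | inj₁ refl = contradiction (λ i j k l → go (x≡0 i) (x≡0 j) (x≡0 k) (x≡0 l)) nc
      where
      x≡0 : ∀ i → proj₁ (V i) ≡ 0ℤ
      x≡0 i with rows i
      ... | inj₁ (_ , l , h) = ≤-antisym h l
      ... | inj₂ (_ , l , h) = ≤-antisym (≤-trans h b≤a) l
      zeros : ∀ py qy ry sy → (0ℤ - 0ℤ) * (sy - ry) - (qy - py) * (0ℤ - 0ℤ) ≡ 0ℤ
      zeros = solve-∀
      go : ∀ {i j k l} → proj₁ (V i) ≡ 0ℤ → proj₁ (V j) ≡ 0ℤ → proj₁ (V k) ≡ 0ℤ → proj₁ (V l) ≡ 0ℤ →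
           cross (V j -² V i) (V l -² V k) ≡ 0ℤ
      go {i} {j} {k} {l} e₁ e₂ e₃ e₄ rewrite e₁ | e₂ | e₃ | e₄ =
        zeros (proj₂ (V i)) (proj₂ (V j)) (proj₂ (V k)) (proj₂ (V l))

    in-Δ : ∀ m → a ≤ m → b + 1ℤ ≤ m → ∀ i → InTriangle 1ℤ m (V i)
    in-Δ m a≤m b≤m i with V i | rows i
    ... | x , y | inj₁ (refl , l , h) = l , nat , certify (gap h ⊕ gap a≤m) (go a m x)
      where
      go : ∀ a m x → (a - x) + (m - a) ≡ m - (x + 1ℤ * 0ℤ)
      go = solve-∀
    ... | x , y | inj₂ (refl , l , h) = l , nat , certify (gap h ⊕ gap b≤m) (go b m x)
      where
      go : ∀ b m x → (b - x) + (m - (b + 1ℤ)) ≡ m - (x + 1ℤ * 1ℤ)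
      go = solve-∀

    2≤D : a + 1ℤ ≤ D → + 2 ≤ D
    2≤D h = certify (gap h ⊕ gap 1≤a) (go a D)
      where
      go : ∀ a D → (D - (a + 1ℤ)) + (a - + 1) ≡ D - + 2
      go = solve-∀

    smaller′ : a + 1ℤ ≤ D → b + 1ℤ ≤ D - 1ℤ → Outcome V D
    smaller′ h₁ h₂ = smaller-along ι (λ i → ι-id (V i)) (2≤D h₁)
      (in-Δ (D - 1ℤ) (certify (gap h₁) (go a D)) h₂)
      where
      go : ∀ a D → D - (a + 1ℤ) ≡ D - 1ℤ - a
      go = solve-∀

    thin′ : b ≡ 0ℤ → a ≡ D → Outcome V D
    thin′ refl refl = thin ι 1≤a (all {InTriangle a a} inside) p q r (at Vp) (at Vq) (at Vr)
      where
      inside : ∀ i → InTriangle a a (V i)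
      inside i with V i | rows i
      ... | x , y | inj₁ (refl , l , h) = l , nat , certify (gap h) (go a x)
        where
        go : ∀ a x → a - x ≡ a - (x + a * 0ℤ)
        go = solve-∀
      ... | x , y | inj₂ (refl , l , h) = l , nat , certify (gap h) (go a x)
        where
        go : ∀ a x → 0ℤ - x ≡ a - (x + a * 1ℤ)
        go = solve-∀

    square′ : a ≡ 1ℤ → b ≡ 1ℤ → D ≡ + 2 → Outcome V D
    square′ refl refl refl = square ι refl (all {InSquare} inside) p q r s (at Vp) (at Vq) (at Vr) (at Vs)
      where
      inside : ∀ i → InSquare (V i)
      inside i with V i | rows i
      ... | x , y | inj₁ (refl , l , h) = (l , h) , nat , nat
      ... | x , y | inj₂ (refl , l , h) = (l , h) , nat , ≤-refl

    main : Outcome V D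
    main with ≤-split b≤a
    main | inj₂ b<a with ≤-or-> D a
    ... | inj₂ a<D = smaller′ (subst (_≤ D) (+-comm 1ℤ a) a<D) (certify (gap b<a ⊕ gap a<D) (go a b D))
      where
      go : ∀ a b D → (a - (+ 1 + b)) + (D - (+ 1 + a)) ≡ D - 1ℤ - (b + 1ℤ)
      go = solve-∀
    ... | inj₁ D≤a = thin′ b≡0 (≤-antisym a≤D D≤a)
      where
      go₁ : ∀ a b D → (a - D) + (D - (a + b)) ≡ 0ℤ - b
      go₁ = solve-∀
      go₂ : ∀ a b D → b + (D - (a + b)) ≡ D - a
      go₂ = solve-∀
      b≡0 : b ≡ 0ℤ
      b≡0 = ≤-antisym (certify (gap D≤a ⊕ gap a+b≤D) (go₁ a b D)) 0≤b
      a≤D : a ≤ D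
      a≤D = certify (0≤b ⊕ gap a+b≤D) (go₂ a b D)
    main | inj₁ refl with ≤-or-> D (a + 1ℤ)
    ... | inj₂ h = smaller′ (certify (gap h ⊕ nat {1}) (go₁ a D)) (certify (gap h) (go₂ a D))
      where
      go₁ : ∀ a D → (D - (+ 1 + (a + 1ℤ))) + + 1 ≡ D - (a + 1ℤ)
      go₁ = solve-∀
      go₂ : ∀ a D → D - (+ 1 + (a + 1ℤ)) ≡ D - 1ℤ - (a + 1ℤ)
      go₂ = solve-∀
    ... | inj₁ D≤a+1 = square′ a≡1 a≡1 D≡2
      where
      go₁ : ∀ a D → (a + 1ℤ - D) + (D - (a + a)) ≡ 1ℤ - a
      go₁ = solve-∀
      a≡1 : a ≡ 1ℤ
      a≡1 = ≤-antisym (certify (gap D≤a+1 ⊕ gap a+b≤D) (go₁ a D)) 1≤a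
      D≡2 : D ≡ + 2
      D≡2 = ≤-antisym (subst (λ t → D ≤ t + 1ℤ) a≡1 D≤a+1) (subst (λ t → t + t ≤ D) a≡1 a+b≤D)

  trapezoid : ∀ {V : Points n} {D a b p q r s} → 0ℤ ≤ a → 0ℤ ≤ b →
    V p ≡ (0ℤ , 0ℤ) → V q ≡ (a , 0ℤ) → V r ≡ (0ℤ , 1ℤ) → V s ≡ (b , 1ℤ) →
    (∀ i → OnRow 0ℤ 0ℤ a (V i) ⊎ OnRow 1ℤ 0ℤ b (V i)) → Claim V D
  trapezoid {V = V} {D} {a} {b} 0≤a 0≤b Vp Vq Vr Vs rows with ≤-total b a
  ... | inj₁ b≤a = wide-trapezoid 0≤b b≤a Vp Vq Vr Vs rows
  ... | inj₂ a≤b = claim-along (flipʸ 1ℤ) (λ i → flipʸ-apply 1ℤ (proj₁ (V i)) (proj₂ (V i)))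
      (wide-trapezoid 0≤a a≤b (cong flip Vr) (cong flip Vs) (cong flip Vp) (cong flip Vq) rows′)
    where
    flip : ℤ² → ℤ²
    flip (x , y) = x , 1ℤ - y
    rows′ : ∀ i → OnRow 0ℤ 0ℤ b (flip (V i)) ⊎ OnRow 1ℤ 0ℤ a (flip (V i))
    rows′ i with V i | rows i
    ... | x , y | inj₁ (refl , h) = inj₂ (refl , h)
    ... | x , y | inj₂ (refl , h) = inj₁ (refl , h)

  row-range : ∀ (V : Points (suc n)) c j → proj₂ (V j) ≡ c →
    ∃[ p ] ∃[ q ] (proj₂ (V p) ≡ c × proj₂ (V q) ≡ c ×
                   (∀ i → proj₂ (V i) ≡ c → proj₁ (V p) ≤ proj₁ (V i) × proj₁ (V i) ≤ proj₁ (V q)))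
  row-range {n} V c j Vj≡c = ρ (lo R) , ρ (hi R) , ρ-row (lo R) , ρ-row (hi R) ,
    λ i h → subst (λ k → _ ≤ proj₁ (V k)) (ρ-fix i h) (lo≤ R i) , subst (λ k → proj₁ (V k) ≤ _) (ρ-fix i h) (≤hi R i)
    where
    -- Indices off the row are sent to `j`, which lies on it; the extremes over all indices are then
    -- those of the row.
    ρ : Fin (suc n) → Fin (suc n)
    ρ i with proj₂ (V i) ≟ c
    ... | yes _ = i
    ... | no _  = j
    ρ-row : ∀ i → proj₂ (V (ρ i)) ≡ c
    ρ-row i with proj₂ (V i) ≟ c
    ... | yes h = h
    ... | no _  = Vj≡c
    ρ-fix : ∀ i → proj₂ (V i) ≡ c → ρ i ≡ i
    ρ-fix i h with proj₂ (V i) ≟ c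
    ... | yes _ = refl
    ... | no nh = contradiction h nh
    R : Range (λ i → proj₁ (V (ρ i)))
    R = range _

  -- A shear along the rows, followed by a translation, brings the left ends of both rows to x = 0.
  two-rows : ∀ {V : Points (suc n)} {D} → (∀ i → proj₂ (V i) ≡ 0ℤ ⊎ proj₂ (V i) ≡ 1ℤ) →
    ∀ j k → proj₂ (V j) ≡ 0ℤ → proj₂ (V k) ≡ 1ℤ → Claim V D
  two-rows {n} {V} {D} rows j k Vj Vk with row-range V 0ℤ j Vj | row-range V 1ℤ k Vk
  ... | p , q , p₀ , q₀ , h₀ | r , s , r₁ , s₁ , h₁ =
    claim-along (shear slope (- x p)) (λ i → shear-apply slope (- x p) (x i) (y i))
      (trapezoid (gap (proj₁ (h₀ q q₀))) (gap (proj₁ (h₁ s s₁))) (row₀ p p₀ (go₁ (x p))) (row₀ q q₀ refl)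
         (row₁ r r₁ (go₁ (x r))) (row₁ s s₁ refl) rows′)
    where
    x y : Fin (suc n) → ℤ
    x i = proj₁ (V i)
    y i = proj₂ (V i)
    slope = x p - x r
    go₁ : ∀ u → u - u ≡ 0ℤ
    go₁ = solve-∀
    go₂ : ∀ k u v → u + k * 0ℤ + - v ≡ u - v
    go₂ = solve-∀
    go₃ : ∀ u v w → w + (u - v) * 1ℤ + - u ≡ w - v
    go₃ = solve-∀
    W : Points (suc n)
    W i = x i + slope * y i + - x p , y i
    row₀ : ∀ i {t} → y i ≡ 0ℤ → x i - x p ≡ t → W i ≡ (t , 0ℤ)
    row₀ i h e rewrite h = cong (_, 0ℤ) (trans (go₂ slope (x i) (x p)) e)
    row₁ : ∀ i {t} → y i ≡ 1ℤ → x i - x r ≡ t → W i ≡ (t , 1ℤ)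
    row₁ i h e rewrite h = cong (_, 1ℤ) (trans (go₃ (x p) (x r) (x i)) e)
    rows′ : ∀ i → OnRow 0ℤ 0ℤ (x q - x p) (W i) ⊎ OnRow 1ℤ 0ℤ (x s - x r) (W i)
    rows′ i with rows i
    ... | inj₁ h = inj₁ (subst (OnRow 0ℤ 0ℤ (x q - x p)) (sym (row₀ i h refl))
                     (refl , gap (proj₁ (h₀ i h)) , +-monoˡ-≤ (- x p) (proj₂ (h₀ i h))))
    ... | inj₂ h = inj₂ (subst (OnRow 1ℤ 0ℤ (x s - x r)) (sym (row₁ i h refl))
                     (refl , gap (proj₁ (h₁ i h)) , +-monoˡ-≤ (- x r) (proj₂ (h₁ i h))))

  -- X, w and Y are the widths of a point set along x, y and x + y.  Between the points attaining the
  -- minimum and the maximum, y rises by β along x + y and drops by β′ along x.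
  data WidthCase (X Y w β β′ D : ℤ) : Set where
    large   : + 1 + (X + Y + w) ≤ + 2 * D → WidthCase X Y w β β′ D
    box     : X ≡ + 2 → Y ≡ + 4 → w ≡ + 2 → WidthCase X Y w β β′ D
    hexagon : X ≡ + 2 → Y ≡ + 2 → w ≡ + 2 → β ≡ + 1 → β′ ≡ + 1 → + 3 ≤ D → WidthCase X Y w β β′ D

  -- Inequalities between widths and area

  module _ {X Y w β β′ u D : ℤ}
    (w≤X : w ≤ X) (X≤Y : X ≤ Y) (0≤β : 0ℤ ≤ β) (0≤β′ : 0ℤ ≤ β′) (β≤w : β ≤ w) (β′≤w : β′ ≤ w)
    (tilt : Y - β ≤ X) (tilt′ : X - β′ ≤ Y)
    (chord′ : X * w + β′ * u ≤ D) (chord : (Y - β) * w - β * u ≤ D) where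

    private
      0≤w : 0ℤ ≤ w
      0≤w = ≤-trans 0≤β β≤w

    -- The chords realising X, Y and w are the vectors (X , -β′), (Y - β , β) and (u , w); `chord′`
    -- and `chord` bound the cross products of the first two with the third. Weighting `chord′` by β
    -- and `chord` by β′ eliminates u, on which no sign is known.
    width-area : w * (X + Y - w) ≤ + 2 * D
    width-area with ≤-split 0≤β′
    -- For β′ = 0 the inequality `chord′` is already free of u, while the factor β + β′ might vanish
    -- and could not be cancelled.
    ... | inj₁ refl = certify (nat {2} ⊗ gap chord′ ⊕ 0≤w ⊗ (gap tilt ⊕ gap β≤w)) (go X Y w β u D)
      where
      go : ∀ X Y w β u D → + 2 * (D - (X * w + 0ℤ * u)) + w * ((X - (Y - β)) + (w - β)) ≡ + 2 * D - w * (X + Y - w)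
      go = solve-∀
    ... | inj₂ 1≤β′ = 0≤i-j⇒j≤i (*-cancelˡ-≤-pos 0ℤ _ (β + β′) {{s-pos}} (subst₂ _≤_ (sym (*-zeroʳ (β + β′))) refl scaled))
      where
      s-pos : Positive (β + β′)
      s-pos = positive (suc[i]≤j⇒i<j (+-mono-≤ 0≤β 1≤β′))
      id₁ : ∀ X Y w β β′ u D →
        (+ 2 * (β * (D - (X * w + β′ * u)) + β′ * (D - ((Y - β) * w - β * u))) +
          w * ((β - β′) * (X - (Y - β)) + (β + β′) * (w - β)))
        ≡ (β + β′) * (+ 2 * D - w * (X + Y - w))
      id₁ = solve-∀
      id₂ : ∀ X Y w β β′ u D →
        (+ 2 * (β * (D - (X * w + β′ * u)) + β′ * (D - ((Y - β) * w - β * u))) +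
          w * ((β′ - β) * (Y - (X - β′)) + (β + β′) * (w - β′)))
        ≡ (β + β′) * (+ 2 * D - w * (X + Y - w))
      id₂ = solve-∀
      scaled : 0ℤ ≤ (β + β′) * (+ 2 * D - w * (X + Y - w))
      -- The sign of β - β′ decides which of `tilt` and `tilt′` enters the remainder with a
      -- nonnegative weight.
      scaled with ≤-total β′ β
      ... | inj₁ β′≤β = subst (0ℤ ≤_) (id₁ X Y w β β′ u D)
            (nat {2} ⊗ (0≤β ⊗ gap chord′ ⊕ 0≤β′ ⊗ gap chord) ⊕
              0≤w ⊗ (gap β′≤β ⊗ gap tilt ⊕ (0≤β ⊕ 0≤β′) ⊗ gap β≤w))
      ... | inj₂ β≤β′ = subst (0ℤ ≤_) (id₂ X Y w β β′ u D)
            (nat {2} ⊗ (0≤β ⊗ gap chord′ ⊕ 0≤β′ ⊗ gap chord) ⊕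
              0≤w ⊗ (gap β≤β′ ⊗ gap tilt′ ⊕ (0≤β ⊕ 0≤β′) ⊗ gap β′≤w))

    private
      excess : w ≤ X + Y - w
      excess = certify (gap w≤X ⊕ gap (≤-trans w≤X X≤Y)) (go X Y w)
        where
        go : ∀ X Y w → (X - w) + (Y - w) ≡ X + Y - w - w
        go = solve-∀

    -- With E = X + Y - w ≥ w, the product w E has to exceed E + 2 w. It does for w ≥ 4, and for w =
    -- 3 if E ≥ 4; for X = Y = w = 3 both are 9.
    wide : + 3 ≤ w → + 1 + (X + Y + w) ≤ + 2 * D
    wide 3≤w with ≤-split 3≤w
    ... | inj₂ 4≤w = certify (gap width-area ⊕ (gap 4≤w ⊗ gap (≤-trans (from-yes (+ 2 ≤? + 4)) E≥4)
                       ⊕ nat {3} ⊗ gap E≥4 ⊕ nat {3})) (go X Y w D)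
      where
      E≥4 : + 4 ≤ X + Y - w
      E≥4 = ≤-trans 4≤w excess
      go : ∀ X Y w D → (+ 2 * D - w * (X + Y - w)) +
        ((w - + 4) * (X + Y - w - + 2) + + 3 * (X + Y - w - + 4) + + 3) ≡ + 2 * D - (+ 1 + (X + Y + w))
      go = solve-∀
    ... | inj₁ refl with ≤-split excess
    ...   | inj₂ 4≤E = certify (gap width-area ⊕ (nat {2} ⊗ gap 4≤E ⊕ nat {1})) (go X Y D)
      where
      go : ∀ X Y D → (+ 2 * D - + 3 * (X + Y - + 3)) + (+ 2 * (X + Y - + 3 - + 4) + + 1) ≡ + 2 * D - (+ 1 + (X + Y + + 3))
      go = solve-∀
    ...   | inj₁ 3≡E = subst (λ s → + 1 + (s + + 3) ≤ + 2 * D) (sym X+Y≡6) (*-monoˡ-≤-nonNeg (+ 2) 5≤D)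
      where
      X+Y≡6 : X + Y ≡ + 6
      X+Y≡6 = trans (go X Y) (cong (_+ + 3) (sym 3≡E))
        where
        go : ∀ X Y → X + Y ≡ X + Y - + 3 + + 3
        go = solve-∀
      -- The bound 9 ≤ 2D improves to 5 ≤ D by integrality.
      5≤D : + 5 ≤ D
      5≤D with ≤-or-> (+ 5) D
      ... | inj₁ p = p
      ... | inj₂ D<5 = contradiction (≤-trans (subst (λ s → + 3 * (s - + 3) ≤ + 2 * D) X+Y≡6 width-area)
                         (certify (nat {2} ⊗ gap D<5) (go D))) (from-no (+ 9 ≤? + 8))
        where
        go : ∀ D → + 2 * (+ 5 - (+ 1 + D)) ≡ + 8 - + 2 * D
        go = solve-∀

  data UpTo2 : ℤ → Set where
    is0 : UpTo2 (+ 0)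
    is1 : UpTo2 (+ 1)
    is2 : UpTo2 (+ 2)

  upTo2 : ∀ {z} → 0ℤ ≤ z → z ≤ + 2 → UpTo2 z
  upTo2 {+ 0} _ _ = is0
  upTo2 {+ 1} _ _ = is1
  upTo2 {+ 2} _ _ = is2
  upTo2 {+ suc (suc (suc n))} _ (+≤+ (ℕ.s≤s (ℕ.s≤s ())))

  -- If a slope vanishes, `chord` or `chord′` alone is free of u; if both are 1, their sum is. For
  -- the remaining slopes `kite` is used, the cross product of the chords realising X and Y.
  width-two : ∀ {X Y β β′ u D : ℤ} → + 2 ≤ X → X ≤ Y → UpTo2 β → UpTo2 β′ →
    Y - β ≤ X → X * + 2 + β′ * u ≤ D → (Y - β) * + 2 - β * u ≤ D → X * β + β′ * (Y - β) ≤ D →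
    WidthCase X Y (+ 2) β β′ D
  width-two {X} {Y} {_} {_} {u} {D} 2≤X X≤Y is0 _ tilt chord′ chord kite =
    large (certify (nat {2} ⊗ gap chord ⊕ (gap X≤Y ⊕ nat {2} ⊗ gap (≤-trans 2≤X X≤Y) ⊕ nat {1})) (go X Y u D))
    where
    go : ∀ X Y u D → + 2 * (D - ((Y - 0ℤ) * + 2 - 0ℤ * u)) + ((Y - X) + + 2 * (Y - + 2) + + 1)
      ≡ + 2 * D - (+ 1 + (X + Y + + 2))
    go = solve-∀
  width-two {X} {Y} {_} {_} {u} {D} 2≤X X≤Y is1 is0 tilt chord′ chord kite =
    large (certify (nat {2} ⊗ gap chord′ ⊕ (gap tilt ⊕ nat {2} ⊗ gap 2≤X)) (go X Y u D))
    where
    go : ∀ X Y u D → + 2 * (D - (X * + 2 + 0ℤ * u)) + ((X - (Y - + 1)) + + 2 * (X - + 2))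
      ≡ + 2 * D - (+ 1 + (X + Y + + 2))
    go = solve-∀
  width-two {X} {Y} {_} {_} {u} {D} 2≤X X≤Y is2 is0 tilt chord′ chord kite with ≤-split 2≤X
  ... | inj₂ 3≤X = large (certify (nat {2} ⊗ gap chord′ ⊕ (gap tilt ⊕ nat {2} ⊗ gap 3≤X ⊕ nat {1})) (go X Y u D))
    where
    go : ∀ X Y u D → + 2 * (D - (X * + 2 + 0ℤ * u)) + ((X - (Y - + 2)) + + 2 * (X - + 3) + + 1)
      ≡ + 2 * D - (+ 1 + (X + Y + + 2))
    go = solve-∀
  ... | inj₁ refl with ≤-or-> (+ 4) Y
  -- The bound D ≥ 4 falls short here, since X + Y + w = 8.
  ...   | inj₁ 4≤Y = box refl (≤-antisym (certify (gap tilt) (go Y)) 4≤Y) refl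
    where
    go : ∀ Y → + 2 - (Y - + 2) ≡ + 4 - Y
    go = solve-∀
  ...   | inj₂ Y<4 = large (certify (nat {2} ⊗ gap chord′ ⊕ gap Y<4) (go Y u D))
    where
    go : ∀ Y u D → + 2 * (D - (+ 2 * + 2 + 0ℤ * u)) + (+ 4 - (+ 1 + Y)) ≡ + 2 * D - (+ 1 + (+ 2 + Y + + 2))
    go = solve-∀
  width-two {X} {Y} {_} {_} {u} {D} 2≤X X≤Y is1 is1 tilt chord′ chord kite with ≤-split 2≤X | ≤-split X≤Y
  -- Here X + Y + w = 6 while `kite` only gives D ≥ 3, so both sizes may equal D.
  ... | inj₁ refl | inj₁ refl = hexagon refl refl refl refl refl kite
  ... | inj₂ 3≤X | _ = large (certify (gap chord ⊕ gap chord′ ⊕ (gap 3≤X ⊕ gap (≤-trans 3≤X X≤Y) ⊕ nat {1})) (go X Y u D))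
    where
    go : ∀ X Y u D → (D - ((Y - + 1) * + 2 - + 1 * u)) + (D - (X * + 2 + + 1 * u)) + ((X - + 3) + (Y - + 3) + + 1)
      ≡ + 2 * D - (+ 1 + (X + Y + + 2))
    go = solve-∀
  ... | inj₁ refl | inj₂ 3≤Y = large (certify (gap chord ⊕ gap chord′ ⊕ gap 3≤Y) (go Y u D))
    where
    go : ∀ Y u D → (D - ((Y - + 1) * + 2 - + 1 * u)) + (D - (+ 2 * + 2 + + 1 * u)) + (Y - + 3)
      ≡ + 2 * D - (+ 1 + (+ 2 + Y + + 2))
    go = solve-∀
  width-two {X} {Y} {_} {_} {u} {D} 2≤X X≤Y is1 is2 tilt chord′ chord kite =
    large (certify (nat {2} ⊗ gap kite ⊕ (gap 2≤X ⊕ nat {3} ⊗ gap (≤-trans 2≤X X≤Y) ⊕ nat {1})) (go X Y D))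
    where
    go : ∀ X Y D → + 2 * (D - (X * + 1 + + 2 * (Y - + 1))) + ((X - + 2) + + 3 * (Y - + 2) + + 1)
      ≡ + 2 * D - (+ 1 + (X + Y + + 2))
    go = solve-∀
  width-two {X} {Y} {_} {_} {u} {D} 2≤X X≤Y is2 is1 tilt chord′ chord kite =
    large (certify (nat {2} ⊗ gap kite ⊕ (nat {3} ⊗ gap 2≤X ⊕ gap (≤-trans 2≤X X≤Y) ⊕ nat {1})) (go X Y D))
    where
    go : ∀ X Y D → + 2 * (D - (X * + 2 + + 1 * (Y - + 2))) + (+ 3 * (X - + 2) + (Y - + 2) + + 1)
      ≡ + 2 * D - (+ 1 + (X + Y + + 2))
    go = solve-∀
  width-two {X} {Y} {_} {_} {u} {D} 2≤X X≤Y is2 is2 tilt chord′ chord kite =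
    large (certify (nat {2} ⊗ gap kite ⊕ (nat {3} ⊗ gap 2≤X ⊕ nat {3} ⊗ gap (≤-trans 2≤X X≤Y) ⊕ nat {1})) (go X Y D))
    where
    go : ∀ X Y D → + 2 * (D - (X * + 2 + + 2 * (Y - + 2))) + (+ 3 * (X - + 2) + + 3 * (Y - + 2) + + 1)
      ≡ + 2 * D - (+ 1 + (X + Y + + 2))
    go = solve-∀

  width-case : ∀ {X Y w β β′ u D : ℤ} → + 2 ≤ w → w ≤ X → X ≤ Y → 0ℤ ≤ β → 0ℤ ≤ β′ → β ≤ w → β′ ≤ w →
    Y - β ≤ X → X - β′ ≤ Y →
    X * w + β′ * u ≤ D → (Y - β) * w - β * u ≤ D → X * β + β′ * (Y - β) ≤ D → WidthCase X Y w β β′ D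
  width-case 2≤w w≤X X≤Y 0≤β 0≤β′ β≤w β′≤w tilt tilt′ chord′ chord kite with ≤-split 2≤w
  ... | inj₁ refl = width-two w≤X X≤Y (upTo2 0≤β β≤w) (upTo2 0≤β′ β′≤w) tilt chord′ chord kite
  ... | inj₂ 3≤w  = large (wide w≤X X≤Y 0≤β 0≤β′ β≤w β′≤w tilt tilt′ chord′ chord 3≤w)

  -- The exceptional triangle inside a hexagon

  4≰3 : ¬ (+ 4 ≤ + 3)
  4≰3 = from-no (+ 4 ≤? + 3)

  -- The three given points alone span twice the area 3, which leaves no room for a point outside
  -- their triangle.
  triangle-case : ∀ {V : Points n} {o p q} →
    V o ≡ (0ℤ , 1ℤ) → V p ≡ (+ 2 , 0ℤ) → V q ≡ (1ℤ , + 2) → Claim V (+ 3)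
  triangle-case {V = V} {o} {p} {q} Vo Vp Vq bd _ =
    triangle φ refl inside o p q (cong (applyℤ φ) Vo) (cong (applyℤ φ) Vp) (cong (applyℤ φ) Vq)
    where
    φ : AffineUnimodular
    -- The map (x , y) ↦ (x + y - 1 , x) takes the given points to (0 , 0), (1 , 2) and (2 , 1), in
    -- this order.
    φ = record { a = 1ℤ ; b = 1ℤ ; c = 1ℤ ; d = 0ℤ ; e = -1ℤ ; f = 0ℤ ; det≡±1 = inj₂ refl }
    -- A point beyond an edge would span more than the area 3 with that edge and the opposite vertex.
    inside : ∀ i → InTriangle₁₂ (applyℤ φ (V i))
    inside i =
      certify (gap (bound-at V bd Vo Vq Vp refl)) (id₁ x y) ,
      certify (gap (bound-at V bd Vo Vp refl Vq)) (id₂ x y) ,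
      certify (gap (bound-at V bd Vp Vq refl Vo)) (id₃ x y)
      where
      x = proj₁ (V i)
      y = proj₂ (V i)
      id₁ : ∀ x y → + 3 - ((1ℤ - 0ℤ) * (y - 0ℤ) - (+ 2 - 1ℤ) * (x - + 2))
        ≡ + 2 * (1ℤ * x + 0ℤ * y + 0ℤ) - (1ℤ * x + 1ℤ * y + -1ℤ)
      id₁ = solve-∀
      id₂ : ∀ x y → + 3 - ((+ 2 - 0ℤ) * (+ 2 - y) - (0ℤ - 1ℤ) * (1ℤ - x))
        ≡ + 2 * (1ℤ * x + 1ℤ * y + -1ℤ) - (1ℤ * x + 0ℤ * y + 0ℤ)
      id₂ = solve-∀
      id₃ : ∀ x y → + 3 - ((1ℤ - + 2) * (1ℤ - y) - (+ 2 - 0ℤ) * (0ℤ - x))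
        ≡ + 3 - ((1ℤ * x + 1ℤ * y + -1ℤ) + (1ℤ * x + 0ℤ * y + 0ℤ))
      id₃ = solve-∀

  data Bit : ℤ → Set where
    O : Bit 0ℤ
    I : Bit 1ℤ

  bit : ∀ {z} → 0ℤ ≤ z → z ≤ 1ℤ → Bit z
  bit {+ 0} _ _ = O
  bit {+ 1} _ _ = I
  bit {+ suc (suc n)} _ (+≤+ (ℕ.s≤s ()))

  -- One point lies on each edge of the hexagon 0 ≤ x , y ≤ 2, 1 ≤ x + y ≤ 3, at the end selected by
  -- the bits. If r and s differ, three alternate corners of the hexagon occur and form the
  -- exceptional triangle; if they agree, two chords have cross product 4.
  hexagon-case : ∀ {V : Points n} {r s t u} {h i j k l m} → Bit r → Bit s → Bit t → Bit u →
    V h ≡ (0ℤ , 1ℤ + r) → V i ≡ (+ 2 , r) → V j ≡ (1ℤ - s , s) → V k ≡ (+ 2 - s , 1ℤ + s) →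
    V l ≡ (1ℤ + t , 0ℤ) → V m ≡ (u , + 2) → Claim V (+ 3)
  hexagon-case {V = V} O I _ _ h i j k l m = triangle-case h i k
  hexagon-case {V = V} I O _ _ h i j k l m =
    claim-along (rotate (+ 2) (+ 2)) (λ z → rotate-apply (+ 2) (+ 2) (proj₁ (V z)) (proj₂ (V z)))
      (triangle-case (cong opposite i) (cong opposite h) (cong opposite j))
    where
    opposite : ℤ² → ℤ²
    opposite (x , y) = + 2 - x , + 2 - y
  hexagon-case {V = V} O O _ O h i j k l m bd _ = contradiction (bound-at V bd h k i m) 4≰3
  hexagon-case {V = V} O O _ I h i j k l m bd _ = contradiction (bound-at V bd h k j m) 4≰3
  hexagon-case {V = V} I I O _ h i j k l m bd _ = contradiction (bound-at V bd j i l k) 4≰3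
  hexagon-case {V = V} I I I _ h i j k l m bd _ = contradiction (bound-at V bd j i l h) 4≰3

  -- Fitting a family into a dilate of Δ

  xs ys sums diffs : Points n → Fin n → ℤ
  xs V i = proj₁ (V i)
  ys V i = proj₂ (V i)
  sums V i = xs V i + ys V i
  diffs V i = xs V i - ys V i

  module _ (V : Points n) (rx : Range (xs V)) (ry : Range (ys V)) (rs : Range (sums V)) where

    -- Sizes of the smallest translated dilates of Δ around the family, in the coordinates (x , y)
    -- and (-x , -y).
    size size° : ℤ
    size  = sums V (hi rs) - xs V (lo rx) - ys V (lo ry)
    size° = xs V (hi rx) + ys V (hi ry) - sums V (lo rs)

    size+size° : size + size° ≡ width rx + width rs + width ry
    size+size° = go (xs V (lo rx)) (xs V (hi rx)) (ys V (lo ry)) (ys V (hi ry)) (sums V (lo rs)) (sums V (hi rs))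
      where
      go : ∀ x x′ y y′ s s′ → (s′ - x - y) + (x′ + y′ - s) ≡ (x′ - x) + (s′ - s) + (y′ - y)
      go = solve-∀

    fit : ∀ {D} → + 2 ≤ D → Outcome V D ⊎ (D ≤ size × D ≤ size°)
    fit {D} 2≤D with ≤-or-> D size | ≤-or-> D size°
    ... | inj₁ p | inj₁ q = inj₂ (p , q)
    ... | inj₂ p | _ = inj₁ (smaller-along (translate (xs V (lo rx)) (ys V (lo ry)))
            (λ i → translate-apply _ _ (xs V i) (ys V i)) 2≤D
            (λ i → gap (lo≤ rx i) , gap (lo≤ ry i) ,
              certify (gap p ⊕ gap (≤hi rs i)) (go D (sums V (hi rs)) (xs V (lo rx)) (ys V (lo ry)) (xs V i) (ys V i))))
      where
      go : ∀ D s x₀ y₀ x y → (D - (+ 1 + (s - x₀ - y₀))) + (s - (x + y)) ≡ D - 1ℤ - (x - x₀ + 1ℤ * (y - y₀))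
      go = solve-∀
    ... | inj₁ _ | inj₂ q = inj₁ (smaller-along (rotate (xs V (hi rx)) (ys V (hi ry)))
            (λ i → rotate-apply _ _ (xs V i) (ys V i)) 2≤D
            (λ i → gap (≤hi rx i) , gap (≤hi ry i) ,
              certify (gap q ⊕ gap (lo≤ rs i)) (go D (sums V (lo rs)) (xs V (hi rx)) (ys V (hi ry)) (xs V i) (ys V i))))
      where
      go : ∀ D s x₁ y₁ x y → (D - (+ 1 + (x₁ + y₁ - s))) + (x + y - s) ≡ D - 1ℤ - (x₁ - x + 1ℤ * (y₁ - y))
      go = solve-∀

    narrow : ∀ {D} → + 2 ≤ D → + 1 + (width rx + width rs + width ry) ≤ + 2 * D → Outcome V D
    narrow {D} 2≤D h with fit 2≤D
    ... | inj₁ o = o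
    ... | inj₂ (p , q) = contradiction (certify (gap h′ ⊕ gap p ⊕ gap q) (go D size size°)) (from-no (1ℤ ≤? 0ℤ))
      where
      h′ : + 1 + (size + size°) ≤ + 2 * D
      h′ = subst (λ t → + 1 + t ≤ + 2 * D) (sym size+size°) h
      go : ∀ D p q → (+ 2 * D - (+ 1 + (p + q))) + (p - D) + (q - D) ≡ 0ℤ - 1ℤ
      go = solve-∀

  flat-collinear : ∀ {V : Points n} (ry : Range (ys V)) → ys V (lo ry) ≡ ys V (hi ry) → Collinear V
  flat-collinear {V = V} ry eq p q r s =
    trans (cong₂ _-_ (cong ((xs V q - xs V p) *_) (level s r)) (cong (_* (xs V s - xs V r)) (level q p)))
          (go (xs V q - xs V p) (xs V s - xs V r))
    where
    flat : ∀ i → ys V i ≡ ys V (lo ry)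
    flat i = ≤-antisym (≤-trans (≤hi ry i) (≤-reflexive (sym eq))) (lo≤ ry i)
    level : ∀ i j → ys V i - ys V j ≡ 0ℤ
    level i j = trans (cong₂ _-_ (flat i) (flat j)) (+-inverseʳ (ys V (lo ry)))
    go : ∀ u v → u * 0ℤ - 0ℤ * v ≡ 0ℤ
    go = solve-∀

  mirror-apply : ∀ x y → applyℤ (flipʸ 0ℤ) (x , y) ≡ (x , - y)
  mirror-apply x y = trans (flipʸ-apply 0ℤ x y) (cong (x ,_) (+-identityˡ (- y)))

  width-neg : ∀ {f : Fin n → ℤ} (r : Range f) → width (range-neg r) ≡ width r
  width-neg {f = f} r = go (f (lo r)) (f (hi r))
    where
    go : ∀ a b → - a - (- b) ≡ b - a
    go = solve-∀

  width-one : ∀ {V : Points (suc n)} {D} (ry : Range (ys V)) → width ry ≡ 1ℤ → Claim V D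
  width-one {V = V} ry w≡1 =
    claim-along (translate 0ℤ y₀) (λ i → translate-apply 0ℤ y₀ (xs V i) (ys V i))
      (two-rows rows (lo ry) (hi ry) (+-inverseʳ y₀) w≡1)
    where
    y₀ = ys V (lo ry)
    rows : ∀ i → ys V i - y₀ ≡ 0ℤ ⊎ ys V i - y₀ ≡ 1ℤ
    rows i with ys V i - y₀ | gap (lo≤ ry i) | subst (ys V i - y₀ ≤_) w≡1 (+-monoˡ-≤ (- y₀) (≤hi ry i))
    ... | z | 0≤z | z≤1 with bit 0≤z z≤1
    ...   | O = inj₁ refl
    ...   | I = inj₂ refl

  module _ {V : Points (suc n)} {D : ℤ}
    (rx : Range (xs V)) (ry : Range (ys V)) (rs : Range (sums V)) (rd : Range (diffs V))
    (w≤X : width ry ≤ width rx) (X≤Y : width rx ≤ width rs) (X≤Z : width rx ≤ width rd)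
    (drop : ys V (hi rx) ≤ ys V (lo rx)) (bound : Bound V D) (spread : ¬ Collinear V) where

    private
      x y : Fin (suc n) → ℤ
      x = xs V
      y = ys V
      X Y w β β′ : ℤ
      X = width rx
      Y = width rs
      w = width ry
      β = y (hi rs) - y (lo rs)
      β′ = y (lo rx) - y (hi rx)

      Y-β : ∀ i j → (x j + y j) - (x i + y i) - (y j - y i) ≡ x j - x i
      Y-β i j = go (x i) (y i) (x j) (y j)
        where
        go : ∀ x y x′ y′ → (x′ + y′) - (x + y) - (y′ - y) ≡ x′ - x
        go = solve-∀

      tilt : Y - β ≤ X
      tilt = subst (_≤ X) (sym (Y-β (lo rs) (hi rs)))
        (+-mono-≤ (≤hi rx (hi rs)) (neg-mono-≤ (lo≤ rx (lo rs))))

      tilt′ : X - β′ ≤ Y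
      tilt′ = subst (_≤ Y) (go (x (lo rx)) (y (lo rx)) (x (hi rx)) (y (hi rx)))
        (+-mono-≤ (≤hi rs (hi rx)) (neg-mono-≤ (lo≤ rs (lo rx))))
        where
        go : ∀ x y x′ y′ → (x′ + y′) - (x + y) ≡ (x′ - x) - (y - y′)
        go = solve-∀

      -- A chord realising Y gains at most X in x, hence at least Y - X in y.
      0≤β : 0ℤ ≤ β
      0≤β = subst (0ℤ ≤_) (go X Y β) (gap tilt ⊕ gap X≤Y)
        where
        go : ∀ X Y b → (X - (Y - b)) + (Y - X) ≡ b
        go = solve-∀

      β≤w : β ≤ w
      β≤w = +-mono-≤ (≤hi ry (hi rs)) (neg-mono-≤ (lo≤ ry (lo rs)))

      β′≤w : β′ ≤ w
      β′≤w = +-mono-≤ (≤hi ry (lo rx)) (neg-mono-≤ (lo≤ ry (hi rx)))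

      chord′ : X * w + β′ * (x (hi ry) - x (lo ry)) ≤ D
      chord′ = subst (_≤ D) (go X w (x (hi ry) - x (lo ry)) (y (lo rx)) (y (hi rx)))
        (bound (lo rx) (hi rx) (lo ry) (hi ry))
        where
        go : ∀ X w u y y′ → X * w - (y′ - y) * u ≡ X * w + (y - y′) * u
        go = solve-∀

      chord : (Y - β) * w - β * (x (hi ry) - x (lo ry)) ≤ D
      chord = subst (λ t → t * w - β * (x (hi ry) - x (lo ry)) ≤ D) (sym (Y-β (lo rs) (hi rs)))
        (bound (lo rs) (hi rs) (lo ry) (hi ry))

      kite : X * β + β′ * (Y - β) ≤ D
      kite = subst (λ t → X * β + β′ * t ≤ D) (sym (Y-β (lo rs) (hi rs)))
        (subst (_≤ D) (go X β (x (hi rs) - x (lo rs)) (y (lo rx)) (y (hi rx)))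
          (bound (lo rx) (hi rx) (lo rs) (hi rs)))
        where
        go : ∀ X b u y y′ → X * b - (y′ - y) * u ≡ X * b + (y - y′) * u
        go = solve-∀

      large-area : + 2 ≤ w → + 1 + (X + Y + w) ≤ + 2 * D → Outcome V D
      large-area 2≤w h = narrow V rx ry rs 2≤D h
        where
        go : ∀ X Y w D → (+ 2 * D - (+ 1 + (X + Y + w))) + (X - w) + (Y - X + (X - w)) + + 3 * (w - + 2) + + 3
          ≡ + 2 * D - + 4
        go = solve-∀
        2≤D : + 2 ≤ D
        2≤D = *-cancelˡ-≤-pos (+ 2) D (+ 2)
          (certify (gap h ⊕ gap w≤X ⊕ (gap X≤Y ⊕ gap w≤X) ⊕ nat {3} ⊗ gap 2≤w ⊕ nat {3}) (go X Y w D))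

      hexagonal : X ≡ + 2 → Y ≡ + 2 → w ≡ + 2 → β ≡ + 1 → β′ ≡ + 1 → + 3 ≤ D → Outcome V D
      hexagonal X≡2 Y≡2 w≡2 β≡1 β′≡1 3≤D with ≤-split 3≤D
      ... | inj₂ 4≤D = narrow V rx ry rs (≤-trans (from-yes (+ 2 ≤? + 3)) 3≤D)
        (subst (λ t → + 1 + t ≤ + 2 * D) (sym (cong₂ _+_ (cong₂ _+_ X≡2 Y≡2) w≡2))
          (≤-trans (from-yes (+ 7 ≤? + 8)) (*-monoˡ-≤-nonNeg (+ 2) 4≤D)))
      ... | inj₁ refl with fit V rx ry rs (from-yes (+ 2 ≤? + 3))
      ...   | inj₁ o = o
      -- Both sizes are at least 3 and their sum is 6, so both equal 3. In coordinates starting at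
      -- (x₀ , y₀) this means 1 ≤ x + y ≤ 3, which confines the points to the hexagon.
      ...   | inj₂ (3≤size , 3≤size°) =
        claim-along (translate x₀ y₀) (λ i → translate-apply x₀ y₀ (x i) (y i))
          (hexagon-case (bit (gap (lo≤ ry (hi rx))) r≤1) (bit (gap (lo≤ ry (lo rs))) s≤1)
                        (bit 0≤t t≤1) (bit (gap (lo≤ rx (hi ry))) u≤1)
            (cong₂ _,_ (+-inverseʳ x₀) y-h)
            (cong (_, r) X≡2)
            (cong (_, s) x-j)
            (cong₂ _,_ x-k y-k)
            (cong₂ _,_ x-l (+-inverseʳ y₀))
            (cong (u ,_) w≡2))
          bound spread
        where
        x₀ y₀ r s t u : ℤ
        x₀ = x (lo rx)
        y₀ = y (lo ry)
        r = y (hi rx) - y₀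
        s = y (lo rs) - y₀
        -- The bottom edge of the hexagon runs from (1 , 0) to (2 , 0), hence the shift by one.
        t = x (lo ry) - x₀ - 1ℤ
        u = x (hi ry) - x₀
        size≡3 : size V rx ry rs ≡ + 3
        size≡3 = ≤-antisym (certify (gap 3≤size°) (trans (go₁ (size V rx ry rs) (size° V rx ry rs))
          (cong (λ z → z - + 3 - size V rx ry rs) total))) 3≤size
          where
          go₁ : ∀ a b → b - + 3 ≡ a + b - + 3 - a
          go₁ = solve-∀
          total : size V rx ry rs + size° V rx ry rs ≡ + 6
          total = trans (size+size° V rx ry rs) (cong₂ _+_ (cong₂ _+_ X≡2 Y≡2) w≡2)
        y-h : y (lo rx) - y₀ ≡ 1ℤ + r
        y-h = trans (go (y (lo rx)) (y (hi rx)) y₀) (cong (_+ r) β′≡1)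
          where
          go : ∀ a b c → a - c ≡ (a - b) + (b - c)
          go = solve-∀
        y-k : y (hi rs) - y₀ ≡ 1ℤ + s
        y-k = trans (go (y (hi rs)) (y (lo rs)) y₀) (cong (_+ s) β≡1)
          where
          go : ∀ a b c → a - c ≡ (a - b) + (b - c)
          go = solve-∀
        x-k : x (hi rs) - x₀ ≡ + 2 - s
        x-k = trans (go (x (hi rs)) (y (hi rs)) (y (lo rs)) x₀ y₀) (cong₂ (λ a b → a - b - s) size≡3 β≡1)
          where
          go : ∀ a b c d e → a - d ≡ (a + b - d - e) - (b - c) - (c - e)
          go = solve-∀
        x-j : x (lo rs) - x₀ ≡ 1ℤ - s
        x-j = trans (go (x (lo rs)) (y (lo rs)) (sums V (hi rs)) x₀ y₀) (cong₂ (λ a b → a - b - s) size≡3 Y≡2)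
          where
          go : ∀ a c f d e → a - d ≡ (f - d - e) - (f - (a + c)) - (c - e)
          go = solve-∀
        x-l : x (lo ry) - x₀ ≡ 1ℤ + t
        x-l = go (x (lo ry) - x₀)
          where
          go : ∀ a → a ≡ 1ℤ + (a - 1ℤ)
          go = solve-∀
        r≤1 : r ≤ 1ℤ
        r≤1 = certify (gap (≤hi ry (lo rx))) (trans (go (y (hi ry)) (y (lo rx)) (y (hi rx)) y₀)
                (cong₂ (λ a b → a - b - r) w≡2 β′≡1))
          where
          go : ∀ a b c d → a - b ≡ (a - d) - (b - c) - (c - d)
          go = solve-∀
        s≤1 : s ≤ 1ℤ
        s≤1 = 0≤i-j⇒j≤i (subst (0ℤ ≤_) x-j (gap (lo≤ rx (lo rs))))
        0≤t : 0ℤ ≤ t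
        0≤t = subst (0ℤ ≤_)
          (trans (go (x (lo ry)) y₀ (x (lo rs)) (y (lo rs)) x₀)
            (trans (cong (λ a → x (lo ry) - x₀ - a - s) x-j) (fin (x (lo ry) - x₀) s)))
          (gap (lo≤ rs (lo ry)))
          where
          go : ∀ a e c d f → a + e - (c + d) ≡ a - f - (c - f) - (d - e)
          go = solve-∀
          fin : ∀ a s → a - (1ℤ - s) - s ≡ a - 1ℤ
          fin = solve-∀
        t≤1 : t ≤ 1ℤ
        t≤1 = certify (gap (≤hi rx (lo ry))) (trans (go (x (hi rx)) (x (lo ry)) x₀)
                (cong (λ a → a - 1ℤ - t) X≡2))
          where
          go : ∀ a b c → a - b ≡ (a - c) - 1ℤ - (b - c - 1ℤ)
          go = solve-∀
        u≤1 : u ≤ 1ℤ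
        u≤1 = certify (gap (≤hi rs (hi ry))) (trans (go (sums V (hi rs)) (x (hi ry)) (y (hi ry)) x₀ y₀)
                (cong₂ (λ a b → a - b - u) size≡3 w≡2))
          where
          go : ∀ a b c d e → a - (b + c) ≡ (a - d - e) - (c - e) - (b - d)
          go = solve-∀

      -- The points realising Y = 4 differ by (2 , 2), so D ≥ 2Z; if Z = 2, then x and -y form
      -- a better basis.
      boxed : X ≡ + 2 → Y ≡ + 4 → w ≡ + 2 → Outcome V D
      boxed X≡2 Y≡4 w≡2 = go-on (≤-split X≤Z)
        where
        p Z : ℤ
        p = x (hi rs) - x (lo rs)
        Z = width rd
        p+β≡4 : p + β ≡ + 4
        p+β≡4 = trans (go (x (hi rs)) (y (hi rs)) (x (lo rs)) (y (lo rs))) Y≡4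
          where
          go : ∀ a b c d → (a - c) + (b - d) ≡ (a + b) - (c + d)
          go = solve-∀
        p≤2 : p ≤ + 2
        p≤2 = subst (p ≤_) X≡2 (+-mono-≤ (≤hi rx (hi rs)) (neg-mono-≤ (lo≤ rx (lo rs))))
        β≤2 : β ≤ + 2
        β≤2 = subst (β ≤_) w≡2 β≤w
        β≡2 : β ≡ + 2
        β≡2 = ≤-antisym β≤2 (certify (gap p≤2) (trans (go p β) (cong (λ t → β - (t - + 2)) p+β≡4)))
          where
          go : ∀ p b → + 2 - p ≡ b - (p + b - + 2)
          go = solve-∀
        p≡2 : p ≡ + 2
        p≡2 = trans (go p β) (cong₂ _-_ p+β≡4 β≡2)
          where
          go : ∀ p b → p ≡ p + b - b
          go = solve-∀
        2Z≤D : + 2 * Z ≤ D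
        2Z≤D = subst (_≤ D) (trans (cong₂ (λ a b → a * (y (lo rd) - y (hi rd)) - b * (x (lo rd) - x (hi rd))) p≡2 β≡2)
                              (go (x (hi rd)) (y (hi rd)) (x (lo rd)) (y (lo rd))))
                  (bound (lo rs) (hi rs) (hi rd) (lo rd))
          where
          go : ∀ a b c d → + 2 * (d - b) - + 2 * (c - a) ≡ + 2 * ((a - b) - (c - d))
          go = solve-∀
        go-on : X ≡ Z ⊎ + 1 + X ≤ Z → Outcome V D
        go-on (inj₂ X<Z) = narrow V rx ry rs (≤-trans (from-yes (+ 2 ≤? + 6)) 6≤D)
          (subst (λ t → + 1 + t ≤ + 2 * D) (sym (cong₂ _+_ (cong₂ _+_ X≡2 Y≡4) w≡2))
            (≤-trans (from-yes (+ 9 ≤? + 12)) (*-monoˡ-≤-nonNeg (+ 2) 6≤D)))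
          where
          6≤D : + 6 ≤ D
          6≤D = ≤-trans (*-monoˡ-≤-nonNeg (+ 2) (subst (λ t → + 1 + t ≤ Z) X≡2 X<Z)) 2Z≤D
        go-on (inj₁ X≡Z) = outcome-along (flipʸ 0ℤ) (λ i → mirror-apply (x i) (y i))
          (narrow _ rx (range-neg ry) rd (≤-trans (from-yes (+ 2 ≤? + 4)) 4≤D)
            (subst (λ t → + 1 + t ≤ + 2 * D) (sym (cong₂ _+_ (cong₂ _+_ X≡2 Z≡2) (trans (width-neg ry) w≡2)))
              (≤-trans (from-yes (+ 7 ≤? + 8)) (*-monoˡ-≤-nonNeg (+ 2) 4≤D))))
          where
          Z≡2 : Z ≡ + 2
          Z≡2 = trans (sym X≡Z) X≡2
          4≤D : + 4 ≤ D
          4≤D = subst (λ t → + 2 * t ≤ D) Z≡2 2Z≤D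

    oriented : Outcome V D
    oriented with ≤-split (0≤width ry)
    ... | inj₁ 0≡w = contradiction (flat-collinear {V = V} ry (sym (i-j≡0⇒i≡j _ _ (sym 0≡w)))) spread
    ... | inj₂ 1≤w with ≤-split 1≤w
    ...   | inj₁ 1≡w = width-one ry (sym 1≡w) bound spread
    ...   | inj₂ 2≤w with width-case 2≤w w≤X X≤Y 0≤β (gap drop) β≤w β′≤w tilt tilt′ chord′ chord kite
    ...     | large h = large-area 2≤w h
    ...     | box X≡2 Y≡4 w≡2 = boxed X≡2 Y≡4 w≡2
    ...     | hexagon X≡2 Y≡2 w≡2 β≡1 β′≡1 3≤D = hexagonal X≡2 Y≡2 w≡2 β≡1 β′≡1 3≤D

  private
    x-[-y] : ∀ x y → x + y ≡ x - (- y)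
    x-[-y] = solve-∀
    [y-x] : ∀ x y → - (x - y) ≡ y - x
    [y-x] = solve-∀

  -- Reflection in y reverses the slope of the chord realising X and exchanges x + y with x - y, so
  -- the widths of both have to dominate X.
  reduced : ∀ {V : Points (suc n)} {D} (rx : Range (xs V)) (ry : Range (ys V)) (rs : Range (sums V)) (rd : Range (diffs V)) →
    width ry ≤ width rx → width rx ≤ width rs → width rx ≤ width rd → Claim V D
  reduced {V = V} rx ry rs rd w≤X X≤Y X≤Z with ≤-total (ys V (hi rx)) (ys V (lo rx))
  ... | inj₁ drop = oriented rx ry rs rd w≤X X≤Y X≤Z drop
  ... | inj₂ rise = claim-along (flipʸ 0ℤ) (λ i → mirror-apply (xs V i) (ys V i))
    (oriented rx (range-neg ry) rd (range-cong (λ i → x-[-y] (xs V i) (ys V i)) rs)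
      (subst (_≤ width rx) (sym (width-neg ry)) w≤X) X≤Z
      (≤-trans X≤Y (≤-reflexive (cong₂ _-_ (x-[-y] (xs V (hi rs)) (ys V (hi rs))) (x-[-y] (xs V (lo rs)) (ys V (lo rs))))))
      (neg-mono-≤ rise))

  -- Reduction of the basis

  linear : ∀ a b c d → a * d - b * c ≡ 1ℤ ⊎ a * d - b * c ≡ -1ℤ → AffineUnimodular
  linear a b c d h = record { a = a ; b = b ; c = c ; d = d ; e = 0ℤ ; f = 0ℤ ; det≡±1 = h }

  -- Lagrange-Gauss reduction with the width in place of the norm: as long as x + y or x - y is
  -- narrower than a coordinate, it replaces that coordinate. The sum of the two widths drops each
  -- time, and `m` bounds it.
  descend : ∀ m {V : Points (suc n)} {D} (rx : Range (xs V)) (ry : Range (ys V)) → width rx + width ry < + m → Claim V D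
  descend zero rx ry h = contradiction (0≤width rx ⊕ 0≤width ry) (<⇒≱ h)
  descend (suc m) {V} {D} rx ry h = go-on (≤-or-> (width rx) (width rs)) (≤-or-> (width rx) (width rd))
                                    (≤-or-> (width ry) (width rs)) (≤-or-> (width ry) (width rd))
    where
    rs : Range (sums V)
    rs = range (sums V)
    rd : Range (diffs V)
    rd = range (diffs V)
    less : ∀ a b c → + 1 + c ≤ a → a + b < + suc m → c + b < + m
    less a b c p q = suc[i]≤j⇒i<j (certify (gap p ⊕ gap (i<j⇒suc[i]≤j q)) (go a b c (+ m)))
      where
      go : ∀ a b c m → (a - (+ 1 + c)) + (+ 1 + m - (+ 1 + (a + b))) ≡ m - (+ 1 + (c + b))
      go = solve-∀
    go-on : _ → _ → _ → _ → Claim V D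
    go-on (inj₂ Y<X) _ _ _ =
      claim-along (linear 1ℤ 1ℤ 0ℤ 1ℤ (inj₁ refl)) (λ i → cong₂ _,_ (go₁ (xs V i) (ys V i)) (go₂ (xs V i) (ys V i)))
        (descend m rs ry (less (width rx) (width ry) (width rs) Y<X h))
      where
      go₁ : ∀ x y → 1ℤ * x + 1ℤ * y + 0ℤ ≡ x + y
      go₁ = solve-∀
      go₂ : ∀ x y → 0ℤ * x + 1ℤ * y + 0ℤ ≡ y
      go₂ = solve-∀
    go-on _ (inj₂ Z<X) _ _ =
      claim-along (linear 1ℤ -1ℤ 0ℤ 1ℤ (inj₁ refl)) (λ i → cong₂ _,_ (go₁ (xs V i) (ys V i)) (go₂ (xs V i) (ys V i)))
        (descend m rd ry (less (width rx) (width ry) (width rd) Z<X h))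
      where
      go₁ : ∀ x y → 1ℤ * x + -1ℤ * y + 0ℤ ≡ x - y
      go₁ = solve-∀
      go₂ : ∀ x y → 0ℤ * x + 1ℤ * y + 0ℤ ≡ y
      go₂ = solve-∀
    go-on _ _ (inj₂ Y<w) _ =
      claim-along (linear 1ℤ 1ℤ 1ℤ 0ℤ (inj₂ refl)) (λ i → cong₂ _,_ (go₁ (xs V i) (ys V i)) (go₂ (xs V i) (ys V i)))
        (descend m rs rx (less (width ry) (width rx) (width rs) Y<w (subst (_< + suc m) (+-comm (width rx) (width ry)) h)))
      where
      go₁ : ∀ x y → 1ℤ * x + 1ℤ * y + 0ℤ ≡ x + y
      go₁ = solve-∀
      go₂ : ∀ x y → 1ℤ * x + 0ℤ * y + 0ℤ ≡ x
      go₂ = solve-∀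
    go-on _ _ _ (inj₂ Z<w) =
      claim-along (linear 1ℤ -1ℤ 1ℤ 0ℤ (inj₁ refl)) (λ i → cong₂ _,_ (go₁ (xs V i) (ys V i)) (go₂ (xs V i) (ys V i)))
        (descend m rd rx (less (width ry) (width rx) (width rd) Z<w (subst (_< + suc m) (+-comm (width rx) (width ry)) h)))
      where
      go₁ : ∀ x y → 1ℤ * x + -1ℤ * y + 0ℤ ≡ x - y
      go₁ = solve-∀
      go₂ : ∀ x y → 1ℤ * x + 0ℤ * y + 0ℤ ≡ x
      go₂ = solve-∀
    go-on (inj₁ X≤Y) (inj₁ X≤Z) (inj₁ w≤Y) (inj₁ w≤Z) with ≤-total (width ry) (width rx)
    ... | inj₁ w≤X = reduced rx ry rs rd w≤X X≤Y X≤Z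
    ... | inj₂ X≤w = claim-along swapˣʸ (λ i → swapˣʸ-apply (xs V i) (ys V i))
      (reduced ry rx (range-cong (λ i → +-comm (xs V i) (ys V i)) rs) (range-cong (λ i → [y-x] (xs V i) (ys V i)) (range-neg rd)) X≤w
        (≤-trans w≤Y (≤-reflexive (cong₂ _-_ (+-comm (xs V (hi rs)) (ys V (hi rs))) (+-comm (xs V (lo rs)) (ys V (lo rs))))))
        (≤-trans w≤Z (≤-reflexive (trans (sym (width-neg rd))
          (cong₂ _-_ ([y-x] (xs V (lo rd)) (ys V (lo rd))) ([y-x] (xs V (hi rd)) (ys V (hi rd))))))))

  classify : ∀ (V : Points (suc n)) D → Claim V D
  classify V D with range (xs V) | range (ys V)
  ... | rx | ry = descend (suc ∣ width rx + width ry ∣) rx ry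
    (suc[i]≤j⇒i<j (≤-reflexive (cong (λ t → + 1 + t) (sym (0≤i⇒+∣i∣≡i (0≤width rx ⊕ 0≤width ry))))))

  -- The area of a polygon as a fan of triangles

  turn : ℤ² → ℤ² → ℤ² → ℤ
  turn a b c = cross (b -² a) (c -² a)

  turn-aab : ∀ a b → turn a a b ≡ 0ℤ
  turn-aab (ax , ay) (bx , by) = go ax ay bx by
    where
    go : ∀ ax ay bx by → (ax - ax) * (by - ay) - (ay - ay) * (bx - ax) ≡ 0ℤ
    go = solve-∀

  turn-abb : ∀ a b → turn a b b ≡ 0ℤ
  turn-abb (ax , ay) (bx , by) = go ax ay bx by
    where
    go : ∀ ax ay bx by → (bx - ax) * (by - ay) - (by - ay) * (bx - ax) ≡ 0ℤ
    go = solve-∀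

  -- The signed area of a triangle is the sum of the areas swept out from `o` along its three edges;
  -- the edge from z back to x counts negatively.
  turn-rotate : ∀ o x y z → turn x y z ≡ turn o x y + turn o y z - turn o x z
  turn-rotate (ox , oy) (ax , ay) (bx , by) (cx , cy) = go ox oy ax ay bx by cx cy
    where
    go : ∀ ox oy ax ay bx by cx cy →
      (bx - ax) * (cy - ay) - (by - ay) * (cx - ax) ≡
      ((ax - ox) * (by - oy) - (ay - oy) * (bx - ox)) + ((bx - ox) * (cy - oy) - (by - oy) * (cx - ox))
        - ((ax - ox) * (cy - oy) - (ay - oy) * (cx - ox))
    go = solve-∀

  -- An inductive form of `TurnsLeft`, from which the deletion of a vertex can be read off by
  -- pattern matching.
  data Convex : List ℤ² → Set where
    []  : Convex []
    _∷_ : ∀ {p ps} → AllPairs (λ q r → 0ℤ < turn p q r) ps → Convex ps → Convex (p ∷ ps)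

  TurnsLeft : List ℤ² → Set
  TurnsLeft vs = ∀ {i j k : Fin (length vs)} → i Fin.< j → j Fin.< k →
                 0ℤ < turn (lookup vs i) (lookup vs j) (lookup vs k)

  convex : ∀ vs → TurnsLeft vs → Convex vs
  convex [] ccw = []
  convex (p ∷ ps) ccw =
    subst (AllPairs _) (tabulate-lookup ps) (AllPairs.tabulate⁺-< (λ i<j → ccw {zero} (ℕ.s≤s ℕ.z≤n) (ℕ.s≤s i<j)))
    ∷ convex ps (λ i<j j<k → ccw (ℕ.s≤s i<j) (ℕ.s≤s j<k))

  convex-drop₁ : ∀ {o x ps} → Convex (o ∷ x ∷ ps) → Convex (o ∷ ps)
  convex-drop₁ ((_ ∷ o-ps) ∷ (_ ∷ cv)) = o-ps ∷ cv

  convex-drop₂ : ∀ {o x y ps} → Convex (o ∷ x ∷ y ∷ ps) → Convex (o ∷ x ∷ ps)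
  convex-drop₂ (((_ ∷ ox-ps) ∷ (_ ∷ o-ps)) ∷ ((_ ∷ x-ps) ∷ (_ ∷ cv))) = (ox-ps ∷ o-ps) ∷ (x-ps ∷ cv)

  convex-tail : ∀ {o ps} → Convex (o ∷ ps) → Convex ps
  convex-tail (_ ∷ cv) = cv

  convex-turn : ∀ {o x y ps} → Convex (o ∷ x ∷ y ∷ ps) → 0ℤ ≤ turn o x y
  convex-turn (((h ∷ _) ∷ _) ∷ _) = <⇒≤ h

  fan : ℤ² → List ℤ² → ℤ
  fan o []           = 0ℤ
  fan o (p ∷ [])     = 0ℤ
  fan o (p ∷ q ∷ ps) = turn o p q + fan o (q ∷ ps)

  -- Moving the origin to `o` changes the shoelace sum by terms that telescope; `cross o p` supplies
  -- the edge that closes the path.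
  shoelace-fan : ∀ o p ps → shoelace o (p ∷ ps) + cross o p ≡ fan o (p ∷ ps)
  shoelace-fan (ox , oy) (px , py) [] = go ox oy px py
    where
    go : ∀ ox oy px py → (px * oy - py * ox) + (ox * py - oy * px) ≡ 0ℤ
    go = solve-∀
  shoelace-fan o@(ox , oy) p@(px , py) (q@(qx , qy) ∷ ps) =
    trans (go ox oy px py qx qy (shoelace o (q ∷ ps))) (cong (_+_ (turn o p q)) (shoelace-fan o q ps))
    where
    go : ∀ ox oy px py qx qy s → ((px * qy - py * qx) + s) + (ox * py - oy * px)
      ≡ ((px - ox) * (qy - oy) - (py - oy) * (qx - ox)) + (s + (ox * qy - oy * qx))
    go = solve-∀

  twiceArea-fan : ∀ o ps → twiceArea (o ∷ ps) ≡ fan o ps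
  twiceArea-fan o@(ox , oy) ps = trans (trans (go ox oy (shoelace o (o ∷ ps))) (shoelace-fan o o ps)) (drop ps)
    where
    go : ∀ ox oy s → s ≡ s + (ox * oy - oy * ox)
    go = solve-∀
    drop : ∀ ps → fan o (o ∷ ps) ≡ fan o ps
    drop [] = refl
    drop (p ∷ ps) = trans (cong (_+ fan o (p ∷ ps)) (turn-aab o p)) (+-identityˡ _)

  -- Unlike in a sublist, an entry may be repeated.
  infix 4 _⊑_

  data _⊑_ {A : Set} : List A → List A → Set where
    stop : ∀ {ys} → [] ⊑ ys
    stay : ∀ {y xs ys} → xs ⊑ y ∷ ys → y ∷ xs ⊑ y ∷ ys
    skip : ∀ {y xs ys} → xs ⊑ ys → xs ⊑ y ∷ ys

  fan-repeat : ∀ o x xs → fan o (x ∷ x ∷ xs) ≡ fan o (x ∷ xs)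
  fan-repeat o x xs = trans (cong (_+ fan o (x ∷ xs)) (turn-abb o x)) (+-identityˡ _)

  fan-base : ∀ o xs → fan o (o ∷ xs) ≡ fan o xs
  fan-base o [] = refl
  fan-base o (x ∷ xs) = trans (cong (_+ fan o (x ∷ xs)) (turn-aab o x)) (+-identityˡ _)

  0≤fan : ∀ {o ys} → Convex (o ∷ ys) → 0ℤ ≤ fan o ys
  0≤fan {ys = []} cv = nat
  0≤fan {ys = x ∷ []} cv = nat
  0≤fan {ys = x ∷ y ∷ ys} cv = convex-turn cv ⊕ 0≤fan (convex-drop₁ cv)

  -- Omitting y cuts off the triangle of y and its two neighbours, which turns left.
  fan-shortcut : ∀ {o x y ys} → Convex (o ∷ x ∷ y ∷ ys) → fan o (x ∷ ys) ≤ fan o (x ∷ y ∷ ys)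
  fan-shortcut {ys = []} cv = convex-turn cv ⊕ nat
  fan-shortcut {o} {x} {y} {z ∷ ys} cv =
    certify (convex-turn (convex-tail cv))
      (trans (turn-rotate o x y z) (go (turn o x y) (turn o y z) (turn o x z) (fan o (z ∷ ys))))
    where
    go : ∀ a b c s → a + b - c ≡ (a + (b + s)) - (c + s)
    go = solve-∀

  fan-drop : ∀ {o y ys} → Convex (o ∷ y ∷ ys) → fan o ys ≤ fan o (y ∷ ys)
  fan-drop {ys = []} cv = nat
  fan-drop {o} {y} {ys = z ∷ ys} cv = certify (convex-turn cv) (go (turn o y z) (fan o (z ∷ ys)))
    where
    go : ∀ a s → a ≡ a + s - s
    go = solve-∀

  -- The vertex chosen last stays at the head of the chain as x, so that the vertices skipped after
  -- it are cut off one at a time.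
  fan-mono-from : ∀ {o x xs ys} → Convex (o ∷ x ∷ ys) → xs ⊑ x ∷ ys → fan o (x ∷ xs) ≤ fan o (x ∷ ys)
  fan-mono-from cv stop = 0≤fan cv
  fan-mono-from {o} {x} cv (stay {xs = xs} p) = ≤-trans (≤-reflexive (fan-repeat o x xs)) (fan-mono-from cv p)
  fan-mono-from cv (skip stop) = 0≤fan cv
  fan-mono-from {o} {x} cv (skip (stay {y} p)) = +-monoʳ-≤ (turn o x y) (fan-mono-from (convex-drop₁ cv) p)
  fan-mono-from cv (skip (skip p)) = ≤-trans (fan-mono-from (convex-drop₂ cv) (skip p)) (fan-shortcut cv)

  fan-mono : ∀ {o xs ys} → Convex (o ∷ ys) → xs ⊑ o ∷ ys → fan o xs ≤ fan o ys
  fan-mono cv stop = 0≤fan cv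
  fan-mono {o} cv (stay {xs = xs} p) = ≤-trans (≤-reflexive (fan-base o xs)) (fan-mono cv p)
  fan-mono cv (skip stop) = 0≤fan cv
  fan-mono cv (skip (stay p)) = fan-mono-from cv p
  fan-mono cv (skip (skip p)) = ≤-trans (fan-mono (convex-drop₁ cv) (skip p)) (fan-drop cv)

  pick₁ : ∀ (vs : List ℤ²) i → lookup vs i ∷ [] ⊑ vs
  pick₁ (v ∷ vs) zero = stay stop
  pick₁ (v ∷ vs) (suc i) = skip (pick₁ vs i)

  pick₂ : ∀ (vs : List ℤ²) i j → i Fin.≤ j → lookup vs i ∷ lookup vs j ∷ [] ⊑ vs
  pick₂ (v ∷ vs) zero j _ = stay (pick₁ (v ∷ vs) j)
  pick₂ (v ∷ vs) (suc i) (suc j) (ℕ.s≤s p) = skip (pick₂ vs i j p)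

  pick₃ : ∀ (vs : List ℤ²) i j k → i Fin.≤ j → j Fin.≤ k → lookup vs i ∷ lookup vs j ∷ lookup vs k ∷ [] ⊑ vs
  pick₃ (v ∷ vs) zero j k _ q = stay (pick₂ (v ∷ vs) j k q)
  pick₃ (v ∷ vs) (suc i) (suc j) (suc k) (ℕ.s≤s p) (ℕ.s≤s q) = skip (pick₃ vs i j k p q)

  -- The indices increase only weakly, which is why `⊑` admits repetitions: degenerate
  -- quadrilaterals are covered along with the proper ones.
  pick₄ : ∀ (vs : List ℤ²) i j k l → i Fin.≤ j → j Fin.≤ k → k Fin.≤ l →
          lookup vs i ∷ lookup vs j ∷ lookup vs k ∷ lookup vs l ∷ [] ⊑ vs
  pick₄ (v ∷ vs) zero j k l _ q r = stay (pick₃ (v ∷ vs) j k l q r)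
  pick₄ (v ∷ vs) (suc i) (suc j) (suc k) (suc l) (ℕ.s≤s p) (ℕ.s≤s q) (ℕ.s≤s r) = skip (pick₄ vs i j k l p q r)

  module _ (vs : List ℤ²) (ccw : TurnsLeft vs) where

    private
      V : Points (length vs)
      V = lookup vs

    0≤turn : ∀ {i j k} → i Fin.≤ j → j Fin.≤ k → 0ℤ ≤ turn (V i) (V j) (V k)
    0≤turn {i} {j} {k} i≤j j≤k with i Finₚ.≟ j | j Finₚ.≟ k
    ... | yes refl | _ = ≤-reflexive (sym (turn-aab (V i) (V k)))
    ... | no _ | yes refl = ≤-reflexive (sym (turn-abb (V i) (V j)))
    ... | no i≢j | no j≢k = <⇒≤ (ccw (Finₚ.≤∧≢⇒< i≤j i≢j) (Finₚ.≤∧≢⇒< j≤k j≢k))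

  -- The cross product of the diagonals is twice the signed area of a b c d, and the fan from `o`
  -- covers the triangle o a d in addition.
  fan-quadrilateral : ∀ o a b c d →
    fan o (a ∷ b ∷ c ∷ d ∷ []) ≡ cross (c -² a) (d -² b) + turn o a d
  fan-quadrilateral (ox , oy) (ax , ay) (bx , by) (cx , cy) (dx , dy) = go ox oy ax ay bx by cx cy dx dy
    where
    go : ∀ ox oy ax ay bx by cx cy dx dy →
      ((ax - ox) * (by - oy) - (ay - oy) * (bx - ox)) +
       (((bx - ox) * (cy - oy) - (by - oy) * (cx - ox)) +
        (((cx - ox) * (dy - oy) - (cy - oy) * (dx - ox)) + 0ℤ))
      ≡ ((cx - ax) * (dy - by) - (cy - ay) * (dx - bx)) + ((ax - ox) * (dy - oy) - (ay - oy) * (dx - ox))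
    go = solve-∀

  quadrilateral-area : ∀ vs → TurnsLeft vs → ∀ {i j k l} → i Fin.≤ j → j Fin.≤ k → k Fin.≤ l →
    cross (lookup vs k -² lookup vs i) (lookup vs l -² lookup vs j) ≤ twiceArea vs
  quadrilateral-area vs@(o ∷ ps) ccw {i} {j} {k} {l} p q r =
    certify (gap fan≤ ⊕ 0≤turn vs ccw {zero} {i} {l} ℕ.z≤n (ℕₚ.≤-trans p (ℕₚ.≤-trans q r)))
      (go (twiceArea vs) (cross (lookup vs k -² lookup vs i) (lookup vs l -² lookup vs j)) (turn o (lookup vs i) (lookup vs l)))
    where
    go : ∀ D Q T → D - (Q + T) + T ≡ D - Q
    go = solve-∀
    fan≤ : cross (lookup vs k -² lookup vs i) (lookup vs l -² lookup vs j) + turn o (lookup vs i) (lookup vs l) ≤ twiceArea vs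
    fan≤ = subst₂ _≤_ (fan-quadrilateral o (lookup vs i) (lookup vs j) (lookup vs k) (lookup vs l)) (sym (twiceArea-fan o ps))
      (fan-mono (convex vs ccw) (pick₄ vs i j k l p q r))

  -- Cross products bounded by twice the area

  cross-sides : ∀ a b c d → cross (b -² a) (d -² c) ≡ turn a b d - turn a b c
  cross-sides (ax , ay) (bx , by) (cx , cy) (dx , dy) = go ax ay bx by cx cy dx dy
    where
    go : ∀ ax ay bx by cx cy dx dy → (bx - ax) * (dy - cy) - (by - ay) * (dx - cx) ≡
      ((bx - ax) * (dy - ay) - (by - ay) * (dx - ax)) - ((bx - ax) * (cy - ay) - (by - ay) * (cx - ax))
    go = solve-∀

  cross-diagonals : ∀ a b c d → cross (c -² a) (d -² b) ≡ turn a b c + turn a c d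
  cross-diagonals (ax , ay) (bx , by) (cx , cy) (dx , dy) = go ax ay bx by cx cy dx dy
    where
    go : ∀ ax ay bx by cx cy dx dy → (cx - ax) * (dy - by) - (cy - ay) * (dx - bx) ≡
      ((bx - ax) * (cy - ay) - (by - ay) * (cx - ax)) + ((cx - ax) * (dy - ay) - (cy - ay) * (dx - ax))
    go = solve-∀

  cross-diagonals′ : ∀ a b c d → cross (c -² a) (d -² b) ≡ turn a b d + turn b c d
  cross-diagonals′ (ax , ay) (bx , by) (cx , cy) (dx , dy) = go ax ay bx by cx cy dx dy
    where
    go : ∀ ax ay bx by cx cy dx dy → (cx - ax) * (dy - by) - (cy - ay) * (dx - bx) ≡
      ((bx - ax) * (dy - ay) - (by - ay) * (dx - ax)) + ((cx - bx) * (dy - by) - (cy - by) * (dx - bx))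
    go = solve-∀

  cross-sides′ : ∀ a b c d → cross (d -² a) (c -² b) ≡ turn a b d - turn a c d
  cross-sides′ (ax , ay) (bx , by) (cx , cy) (dx , dy) = go ax ay bx by cx cy dx dy
    where
    go : ∀ ax ay bx by cx cy dx dy → (dx - ax) * (cy - by) - (dy - ay) * (cx - bx) ≡
      ((bx - ax) * (dy - ay) - (by - ay) * (dx - ax)) - ((cx - ax) * (dy - ay) - (cy - ay) * (dx - ax))
    go = solve-∀

  cross-swap : ∀ p q r s → cross (q -² p) (s -² r) ≡ - cross (s -² r) (q -² p)
  cross-swap (px , py) (qx , qy) (rx , ry) (sx , sy) = go px py qx qy rx ry sx sy
    where
    go : ∀ px py qx qy rx ry sx sy →
      (qx - px) * (sy - ry) - (qy - py) * (sx - rx) ≡ - ((sx - rx) * (qy - py) - (sy - ry) * (qx - px))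
    go = solve-∀

  cross-reverse : ∀ p q r s → cross (q -² p) (s -² r) ≡ - cross (q -² p) (r -² s)
  cross-reverse p q r s = trans (cross-flip p q r s) (-1*i≡-i _)

  -- Two-sided, because reordering the four points may change the sign of the cross product.
  AbsBound : ℤ → ℤ → Set
  AbsBound D z = z ≤ D × - z ≤ D

  abs-neg : ∀ {D z z′} → z ≡ - z′ → AbsBound D z′ → AbsBound D z
  abs-neg {D} {_} {z′} refl (p , q) = q , subst (_≤ D) (sym (neg-involutive z′)) p

  module _ (vs : List ℤ²) (ccw : TurnsLeft vs) where

    private
      V : Points (length vs)
      V = lookup vs
      D : ℤ
      D = twiceArea vs

      Spans : (i j k l : Fin (length vs)) → Set
      Spans i j k l = AbsBound D (cross (V j -² V i) (V l -² V k))

      swap : ∀ i j k l → Spans k l i j → Spans i j k l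
      swap i j k l = abs-neg (cross-swap (V i) (V j) (V k) (V l))

      reverse : ∀ i j k l → Spans i j l k → Spans i j k l
      reverse i j k l = abs-neg (cross-reverse (V i) (V j) (V k) (V l))

      -- Four vertices in cyclic order form pairs in three ways. The cross product of the diagonals
      -- is a sum of two turns that make up the quadrilateral; that of opposite sides is a
      -- difference of two turns, each belonging to such a sum.
      module Sorted (i j k l : Fin (length vs)) (p : i Fin.≤ j) (q : j Fin.≤ k) (r : k Fin.≤ l) where
        ijk = turn (V i) (V j) (V k)
        ikl = turn (V i) (V k) (V l)
        ijl = turn (V i) (V j) (V l)
        jkl = turn (V j) (V k) (V l)
        0≤ijk : 0ℤ ≤ ijk
        0≤ijk = 0≤turn vs ccw {i} {j} {k} p q
        0≤ikl : 0ℤ ≤ ikl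
        0≤ikl = 0≤turn vs ccw {i} {k} {l} (ℕₚ.≤-trans p q) r
        0≤ijl : 0ℤ ≤ ijl
        0≤ijl = 0≤turn vs ccw {i} {j} {l} p (ℕₚ.≤-trans q r)
        0≤jkl : 0ℤ ≤ jkl
        0≤jkl = 0≤turn vs ccw {j} {k} {l} q r
        Q≤D : ijk + ikl ≤ D
        Q≤D = subst (_≤ D) (cross-diagonals (V i) (V j) (V k) (V l)) (quadrilateral-area vs ccw {i} {j} {k} {l} p q r)
        Q′≤D : ijl + jkl ≤ D
        Q′≤D = subst (_≤ D) (cross-diagonals′ (V i) (V j) (V k) (V l)) (quadrilateral-area vs ccw {i} {j} {k} {l} p q r)

        upper : ∀ a b c → 0ℤ ≤ b → 0ℤ ≤ c → a + b ≤ D → a - c ≤ D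
        upper a b c hb hc h = certify (gap h ⊕ hb ⊕ hc) (go a b c D)
          where
          go : ∀ a b c D → D - (a + b) + b + c ≡ D - (a - c)
          go = solve-∀

        lower : ∀ a c d → 0ℤ ≤ a → 0ℤ ≤ d → c + d ≤ D → - (a - c) ≤ D
        lower a c d ha hd h = certify (gap h ⊕ ha ⊕ hd) (go a c d D)
          where
          go : ∀ a c d D → D - (c + d) + a + d ≡ D - (- (a - c))
          go = solve-∀

        ij-kl : Spans i j k l
        ij-kl = subst (AbsBound D) (sym (cross-sides (V i) (V j) (V k) (V l)))
          (upper ijl jkl ijk 0≤jkl 0≤ijk Q′≤D , lower ijl ijk ikl 0≤ijl 0≤ikl Q≤D)

        ik-jl : Spans i k j l
        ik-jl = subst (AbsBound D) (sym (cross-diagonals (V i) (V j) (V k) (V l)))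
          (Q≤D , ≤-trans (neg-≤ (0≤ijk ⊕ 0≤ikl)) Q≤D)
          where
          neg-≤ : ∀ {z} → 0ℤ ≤ z → - z ≤ z
          neg-≤ h = ≤-trans (neg-mono-≤ h) h

        il-jk : Spans i l j k
        il-jk = subst (AbsBound D) (sym (cross-sides′ (V i) (V j) (V k) (V l)))
          (upper ijl jkl ikl 0≤jkl 0≤ikl Q′≤D , lower ijl ikl ijk 0≤ijl 0≤ijk (subst (_≤ D) (+-comm ijk ikl) Q≤D))

      spans₁ : ∀ i j k l → i Fin.≤ j → k Fin.≤ l → i Fin.≤ k → Spans i j k l
      spans₁ i j k l i≤j k≤l i≤k =
        [ (λ j≤k → Sorted.ij-kl i j k l i≤j j≤k k≤l)
        , (λ k≤j → [ Sorted.ik-jl i k j l i≤k k≤j , Sorted.il-jk i k l j i≤k k≤l ]′ (Finₚ.≤-total j l)) ]′ (Finₚ.≤-total j k)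

      spans₂ : ∀ i j k l → i Fin.≤ j → k Fin.≤ l → Spans i j k l
      spans₂ i j k l i≤j k≤l =
        [ spans₁ i j k l i≤j k≤l , (λ k≤i → swap i j k l (spans₁ k l i j k≤l i≤j k≤i)) ]′ (Finₚ.≤-total i k)

      spans₃ : ∀ i j k l → i Fin.≤ j → Spans i j k l
      spans₃ i j k l i≤j =
        [ spans₂ i j k l i≤j , (λ l≤k → reverse i j k l (spans₂ i j l k i≤j l≤k)) ]′ (Finₚ.≤-total k l)

      spans : ∀ i j k l → Spans i j k l
      spans i j k l =
        [ spans₃ i j k l , (λ j≤i → swap i j k l (reverse k l i j (swap k l j i (spans₃ j i k l j≤i)))) ]′ (Finₚ.≤-total i j)

    polygon-bound : Bound V D
    polygon-bound i j k l = proj₁ (spans i j k l)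

  -- Lattice polygons inside the exceptional regions

  squarePoints : List ℤ²
  squarePoints = (0ℤ , 0ℤ) ∷ (0ℤ , 1ℤ) ∷ (1ℤ , 0ℤ) ∷ (1ℤ , 1ℤ) ∷ []

  trianglePoints : List ℤ²
  trianglePoints = (0ℤ , 0ℤ) ∷ (1ℤ , 1ℤ) ∷ (1ℤ , + 2) ∷ (+ 2 , 1ℤ) ∷ []

  inSquare⇒∈ : ∀ {v} → InSquare v → v ∈ squarePoints
  inSquare⇒∈ {x , y} ((0≤x , x≤1) , (0≤y , y≤1)) with bit 0≤x x≤1 | bit 0≤y y≤1
  ... | O | O = here refl
  ... | O | I = there (here refl)
  ... | I | O = there (there (here refl))
  ... | I | I = there (there (there (here refl)))

  third : ∀ {x y} → x ≤ + 2 * y → y ≤ + 2 * x → 0ℤ ≤ x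
  third {x} {y} p q = *-cancelˡ-≤-pos 0ℤ x (+ 3) (subst (0ℤ ≤_) (id x y) (gap p ⊕ nat {2} ⊗ gap q))
    where
    id : ∀ x y → (+ 2 * y - x) + + 2 * (+ 2 * x - y) ≡ + 3 * x
    id = solve-∀

  inTriangle₁₂⇒∈ : ∀ {v} → InTriangle₁₂ v → v ∈ trianglePoints
  inTriangle₁₂⇒∈ {x , y} (h₁ , h₂ , h₃) = go (upTo2 (third h₁ h₂) (two h₁ h₃ (id₁ x y)))
                                            (upTo2 (third h₂ h₁) (two h₂ (subst (_≤ + 3) (+-comm x y) h₃) (id₁ y x))) h₁ h₂ h₃
    where
    id₁ : ∀ x y → (+ 2 * y - x) + + 2 * (+ 3 - (x + y)) ≡ + 6 - + 3 * x
    id₁ = solve-∀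
    two : ∀ {x y} → x ≤ + 2 * y → x + y ≤ + 3 → (+ 2 * y - x) + + 2 * (+ 3 - (x + y)) ≡ + 6 - + 3 * x → x ≤ + 2
    two {x} p q eq = *-cancelˡ-≤-pos x (+ 2) (+ 3) (certify (gap p ⊕ nat {2} ⊗ gap q) eq)
    go : ∀ {x y} → UpTo2 x → UpTo2 y → x ≤ + 2 * y → y ≤ + 2 * x → x + y ≤ + 3 → (x , y) ∈ trianglePoints
    go is0 is0 _ _ _ = here refl
    go is0 is1 _ h _ = contradiction h (from-no (+ 1 ≤? + 0))
    go is0 is2 _ h _ = contradiction h (from-no (+ 2 ≤? + 0))
    go is1 is0 h _ _ = contradiction h (from-no (+ 1 ≤? + 0))
    go is1 is1 _ _ _ = there (here refl)
    go is1 is2 _ _ _ = there (there (here refl))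
    go is2 is0 h _ _ = contradiction h (from-no (+ 2 ≤? + 0))
    go is2 is1 _ _ _ = there (there (there (here refl)))
    go is2 is2 _ _ h = contradiction h (from-no (+ 4 ≤? + 3))

  square-turn : ∀ {a b c} → a ∈ squarePoints → b ∈ squarePoints → c ∈ squarePoints → turn a b c ≤ 1ℤ
  square-turn a b c = All.lookup (All.lookup (All.lookup table a) b) c
    where
    table = from-yes (all? (λ a → all? (λ b → all? (λ c → turn a b c ≤? 1ℤ) squarePoints) squarePoints) squarePoints)

  -- Two of five points in a set of four coincide, and every possible coincidence makes one of these
  -- turns vanish.
  square-five : ∀ {a b c d e} → a ∈ squarePoints → b ∈ squarePoints → c ∈ squarePoints → d ∈ squarePoints → e ∈ squarePoints →
    turn a b c ≡ 0ℤ ⊎ (turn a b d ≡ 0ℤ ⊎ turn a c d ≡ 0ℤ) ⊎ (turn a b e ≡ 0ℤ ⊎ turn a c e ≡ 0ℤ ⊎ turn a d e ≡ 0ℤ)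
  square-five a b c d e = All.lookup (All.lookup (All.lookup (All.lookup (All.lookup table a) b) c) d) e
    where
    table = from-yes (all? (λ a → all? (λ b → all? (λ c → all? (λ d → all? (λ e →
      (turn a b c ≟ 0ℤ) ⊎-dec ((turn a b d ≟ 0ℤ) ⊎-dec (turn a c d ≟ 0ℤ))
        ⊎-dec ((turn a b e ≟ 0ℤ) ⊎-dec (turn a c e ≟ 0ℤ) ⊎-dec (turn a d e ≟ 0ℤ)))
      squarePoints) squarePoints) squarePoints) squarePoints) squarePoints)

  triangle-turn : ∀ {a b c} → a ∈ trianglePoints → b ∈ trianglePoints → c ∈ trianglePoints → turn a b c ≤ + 3
  triangle-turn a b c = All.lookup (All.lookup (All.lookup table a) b) c
    where
    table = from-yes (all? (λ a → all? (λ b → all? (λ c → turn a b c ≤? + 3) trianglePoints) trianglePoints) trianglePoints)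

  -- The point (1 , 1) is interior to the triangle of the other three, so no four of these points
  -- are in convex position. Products compare the orientations of two triples without fixing a sign,
  -- as is needed for maps of either determinant.
  triangle-four : ∀ {a b c d} → a ∈ trianglePoints → b ∈ trianglePoints → c ∈ trianglePoints → d ∈ trianglePoints →
    turn a b c * turn a b d ≤ 0ℤ ⊎ turn a b c * turn a c d ≤ 0ℤ ⊎ turn a b c * turn b c d ≤ 0ℤ
  triangle-four a b c d = All.lookup (All.lookup (All.lookup (All.lookup table a) b) c) d
    where
    table = from-yes (all? (λ a → all? (λ b → all? (λ c → all? (λ d →
      (turn a b c * turn a b d ≤? 0ℤ) ⊎-dec (turn a b c * turn a c d ≤? 0ℤ) ⊎-dec (turn a b c * turn b c d ≤? 0ℤ))
      trianglePoints) trianglePoints) trianglePoints) trianglePoints)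

  turn-flip : ∀ a b c → turn a b c ≡ -1ℤ * turn a c b
  turn-flip (ax , ay) (bx , by) (cx , cy) = go ax ay bx by cx cy
    where
    go : ∀ ax ay bx by cx cy → (bx - ax) * (cy - ay) - (by - ay) * (cx - ax) ≡ -1ℤ * ((cx - ax) * (by - ay) - (cy - ay) * (bx - ax))
    go = solve-∀

  -- A transformation may reverse the orientation, so a turn of the original points is a turn of
  -- their images up to the order of the points.
  turn-preimage : ∀ φ a b c → let a′ = applyℤ φ a; b′ = applyℤ φ b; c′ = applyℤ φ c in
    turn a b c ≡ turn a′ b′ c′ ⊎ turn a b c ≡ turn a′ c′ b′
  turn-preimage φ a b c = go (AffineUnimodular.det≡±1 φ)
    where
    go : det φ ≡ 1ℤ ⊎ det φ ≡ -1ℤ → _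
    go (inj₁ u) = inj₁ (sym (trans (cross-apply φ a b a c) (trans (cong (_* turn a b c) u) (*-identityˡ (turn a b c)))))
    go (inj₂ u) = inj₂ (sym (trans (cross-apply φ a c a b) (trans (cong (_* turn a c b) u) (sym (turn-flip a b c)))))

  module _ (φ : AffineUnimodular) {vs : List ℤ²} (ccw : TurnsLeft vs) where

    private
      W : Points (length vs)
      W i = applyℤ φ (lookup vs i)

    -- Both image turns carry the factor `det φ`, whose square is 1.
    image-turns-agree : ∀ {i j k i′ j′ k′} → i Fin.< j → j Fin.< k → i′ Fin.< j′ → j′ Fin.< k′ →
      0ℤ < turn (W i) (W j) (W k) * turn (W i′) (W j′) (W k′)
    image-turns-agree {i} {j} {k} {i′} {j′} {k′} p q p′ q′ =
      subst (0ℤ <_) (sym product) (subst (_< s * t) (*-zeroʳ s)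
        (*-monoˡ-<-pos s {{positive (ccw {i} {j} {k} p q)}} (ccw {i′} {j′} {k′} p′ q′)))
      where
      s t : ℤ
      s = turn (lookup vs i) (lookup vs j) (lookup vs k)
      t = turn (lookup vs i′) (lookup vs j′) (lookup vs k′)
      unit : det φ ≡ 1ℤ ⊎ det φ ≡ -1ℤ → det φ * det φ ≡ 1ℤ
      unit (inj₁ u) = cong₂ _*_ u u
      unit (inj₂ u) = cong₂ _*_ u u
      go : ∀ d s t → (d * s) * (d * t) ≡ (d * d) * (s * t)
      go = solve-∀
      product : turn (W i) (W j) (W k) * turn (W i′) (W j′) (W k′) ≡ s * t
      product = trans (cong₂ _*_ (cross-apply φ (lookup vs i) (lookup vs j) (lookup vs i) (lookup vs k))
                                 (cross-apply φ (lookup vs i′) (lookup vs j′) (lookup vs i′) (lookup vs k′)))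
        (trans (go (det φ) s t) (trans (cong (_* (s * t)) (unit (AffineUnimodular.det≡±1 φ))) (*-identityˡ (s * t))))

    image-turn≢0 : ∀ {i j k} → i Fin.< j → j Fin.< k → turn (W i) (W j) (W k) ≢ 0ℤ
    image-turn≢0 {i} {j} {k} p q eq = <-irrefl (sym (cong (λ t → t * t) eq)) (image-turns-agree {i} {j} {k} {i} {j} {k} p q p q)

  module _ (φ : AffineUnimodular) where

    turn≤ : ∀ ts {m} → (∀ {a b c} → a ∈ ts → b ∈ ts → c ∈ ts → turn a b c ≤ m) →
      ∀ {a b c} → applyℤ φ a ∈ ts → applyℤ φ b ∈ ts → applyℤ φ c ∈ ts → turn a b c ≤ m
    turn≤ ts {m} h {a} {b} {c} a∈ b∈ c∈ =
      [ (λ eq → subst (_≤ m) (sym eq) (h a∈ b∈ c∈)) , (λ eq → subst (_≤ m) (sym eq) (h a∈ c∈ b∈)) ]′ (turn-preimage φ a b c)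

    -- With at most four vertices the fan has at most two triangles, each contributing at most 1.
    square-area : ∀ vs → TurnsLeft vs → (∀ i → applyℤ φ (lookup vs i) ∈ squarePoints) → twiceArea vs ≤ + 2
    square-area [] ccw h = nat
    square-area (o ∷ []) ccw h = subst (_≤ + 2) (sym (twiceArea-fan o [])) nat
    square-area (o ∷ p ∷ []) ccw h = subst (_≤ + 2) (sym (twiceArea-fan o (p ∷ []))) nat
    square-area (o ∷ p ∷ q ∷ []) ccw h = subst (_≤ + 2) (sym (twiceArea-fan o (p ∷ q ∷ [])))
      (+-mono-≤ (turn≤ squarePoints square-turn {o} {p} {q} (h 0F) (h 1F) (h 2F)) (nat {1}))
    square-area (o ∷ p ∷ q ∷ r ∷ []) ccw h = subst (_≤ + 2) (sym (twiceArea-fan o (p ∷ q ∷ r ∷ [])))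
      (+-mono-≤ (turn≤ squarePoints square-turn {o} {p} {q} (h 0F) (h 1F) (h 2F))
        (+-mono-≤ (turn≤ squarePoints square-turn {o} {q} {r} (h 0F) (h 2F) (h 3F)) (nat {0})))
    square-area vs@(_ ∷ _ ∷ _ ∷ _ ∷ _ ∷ _) ccw h =
      contradiction (square-five {W 0F} {W 1F} {W 2F} {W 3F} {W 4F} (h 0F) (h 1F) (h 2F) (h 3F) (h 4F))
      [ image-turn≢0 φ ccw {0F} {1F} {2F} z<s (s<s z<s)
      , [ [ image-turn≢0 φ ccw {0F} {1F} {3F} z<s (s<s z<s) , image-turn≢0 φ ccw {0F} {2F} {3F} z<s (s<s (s<s z<s)) ]′
        , [ image-turn≢0 φ ccw {0F} {1F} {4F} z<s (s<s z<s)
          , [ image-turn≢0 φ ccw {0F} {2F} {4F} z<s (s<s (s<s z<s)) , image-turn≢0 φ ccw {0F} {3F} {4F} z<s (s<s (s<s (s<s z<s))) ]′ ]′ ]′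
      ]′
      where
      W : Points (length vs)
      W i = applyℤ φ (lookup vs i)

    triangle-area : ∀ vs → TurnsLeft vs → (∀ i → applyℤ φ (lookup vs i) ∈ trianglePoints) → twiceArea vs ≤ + 3
    triangle-area [] ccw h = nat
    triangle-area (o ∷ []) ccw h = subst (_≤ + 3) (sym (twiceArea-fan o [])) nat
    triangle-area (o ∷ p ∷ []) ccw h = subst (_≤ + 3) (sym (twiceArea-fan o (p ∷ []))) nat
    triangle-area (o ∷ p ∷ q ∷ []) ccw h = subst (_≤ + 3) (sym (twiceArea-fan o (p ∷ q ∷ [])))
      (+-mono-≤ (turn≤ trianglePoints triangle-turn {o} {p} {q} (h 0F) (h 1F) (h 2F)) (nat {0}))
    triangle-area vs@(_ ∷ _ ∷ _ ∷ _ ∷ _) ccw h =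
      contradiction (triangle-four {W 0F} {W 1F} {W 2F} {W 3F} (h 0F) (h 1F) (h 2F) (h 3F))
        [ <⇒≱ (image-turns-agree φ ccw {0F} {1F} {2F} {0F} {1F} {3F} z<s (s<s z<s) z<s (s<s z<s))
        , [ <⇒≱ (image-turns-agree φ ccw {0F} {1F} {2F} {0F} {2F} {3F} z<s (s<s z<s) z<s (s<s (s<s z<s)))
          , <⇒≱ (image-turns-agree φ ccw {0F} {1F} {2F} {1F} {2F} {3F} z<s (s<s z<s) (s<s z<s) (s<s (s<s z<s))) ]′ ]′
      where
      W : Points (length vs)
      W i = applyℤ φ (lookup vs i)

open Lattice
open import Data.Integer.Base as ℤ using (ℤ; +_; 0ℤ; 1ℤ; -1ℤ)
import Data.Integer.Properties as ℤ
import Data.Integer.Tactic.RingSolver as ℤ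
open import Data.Rational.Base hiding (_/_)
open import Data.Rational.Properties
open import Data.Rational.Unnormalised.Base using (*≡*)
import Data.Rational.Unnormalised.Properties as ℚᵘ
open import Algebra.Properties.CommutativeMonoid.Sum +-0-commutativeMonoid using (sum)
open import Tactic.RingSolver using (solve-∀)
open import Tactic.RingSolver.Core.AlmostCommutativeRing using (AlmostCommutativeRing; fromCommutativeRing)

-- Rational arithmetic

ℚ-ring : AlmostCommutativeRing 0ℓ 0ℓ
ℚ-ring = fromCommutativeRing +-*-commutativeRing (λ x → dec⇒maybe (0ℚ ≟ x))

infixl 6 _⊞_
infixl 7 _⊠_

_⊞_ : ∀ {a b} → 0ℚ ≤ a → 0ℚ ≤ b → 0ℚ ≤ a + b
_⊞_ = +-mono-≤

_⊠_ : ∀ {a b} → 0ℚ ≤ a → 0ℚ ≤ b → 0ℚ ≤ a * b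
_⊠_ {a} {b} p q = subst (_≤ a * b) (*-zeroʳ a) (*-monoˡ-≤-nonNeg a {{nonNegative p}} q)

p≤q⇒0≤q-p : ∀ {p q} → p ≤ q → 0ℚ ≤ q - p
p≤q⇒0≤q-p {p} {q} h = subst (_≤ q - p) (+-inverseʳ p) (+-monoˡ-≤ (- p) h)

0≤q-p⇒p≤q : ∀ {p q} → 0ℚ ≤ q - p → p ≤ q
0≤q-p⇒p≤q {p} {q} h = subst₂ _≤_ (+-identityˡ p) (go p q) (+-monoˡ-≤ p h)
  where
  go : ∀ p q → q - p + p ≡ q
  go = solve-∀ ℚ-ring

-- The embedding of the integers

fromℤ-+ : ∀ a b → fromℤ (a ℤ.+ b) ≡ fromℤ a + fromℤ b
fromℤ-+ a b = toℚᵘ-injective (ℚᵘ.≃-trans (*≡* (go a b)) (ℚᵘ.≃-sym (toℚᵘ-homo-+ (fromℤ a) (fromℤ b))))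
  where
  go : ∀ a b → (a ℤ.+ b) ℤ.* 1ℤ ≡ (a ℤ.* 1ℤ ℤ.+ b ℤ.* 1ℤ) ℤ.* 1ℤ
  go = ℤ.solve-∀

fromℤ-* : ∀ a b → fromℤ (a ℤ.* b) ≡ fromℤ a * fromℤ b
fromℤ-* a b = toℚᵘ-injective (ℚᵘ.≃-trans (*≡* refl) (ℚᵘ.≃-sym (toℚᵘ-homo-* (fromℤ a) (fromℤ b))))

fromℤ-mono-≤ : ∀ {a b} → a ℤ.≤ b → fromℤ a ≤ fromℤ b
fromℤ-mono-≤ {a} {b} h = *≤* (ℤ.*-monoʳ-≤-nonNeg 1ℤ h)

fromℤ-cancel-≤ : ∀ {a b} → fromℤ a ≤ fromℤ b → a ℤ.≤ b
fromℤ-cancel-≤ {a} {b} (*≤* h) = ℤ.*-cancelʳ-≤-pos a b 1ℤ h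

fromℤ-affine : ∀ a b c x y → fromℤ (a ℤ.* x ℤ.+ b ℤ.* y ℤ.+ c) ≡ fromℤ a * fromℤ x + fromℤ b * fromℤ y + fromℤ c
fromℤ-affine a b c x y = trans (fromℤ-+ (a ℤ.* x ℤ.+ b ℤ.* y) c) (cong (_+ fromℤ c)
  (trans (fromℤ-+ (a ℤ.* x) (b ℤ.* y)) (cong₂ _+_ (fromℤ-* a x) (fromℤ-* b y))))

apply-fromℤ² : ∀ φ v → apply φ (fromℤ² v) ≡ fromℤ² (applyℤ φ v)
apply-fromℤ² φ (x , y) = cong₂ _,_ (sym (fromℤ-affine a b e x y)) (sym (fromℤ-affine c d f x y))
  where open AffineUnimodular φ using (a; b; c; d; e; f)

-- Convex hulls

-- The cone over conv ps, with the total weight t as height; conv ps is its slice at height one.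
data Cone : List ℚ² → ℚ → ℚ² → Set where
  nil  : Cone [] 0ℚ (0ℚ , 0ℚ)
  cons : ∀ {p ps a t x y} → 0ℚ ≤ a → Cone ps t (x , y) →
         Cone (p ∷ ps) (a + t) (a * proj₁ p + x , a * proj₂ p + y)

weights⇒cone : ∀ ps (w : Fin (length ps) → ℚ) → (∀ i → 0ℚ ≤ w i) →
  Cone ps (sum w) (sum (λ i → w i * proj₁ (lookup ps i)) , sum (λ i → w i * proj₂ (lookup ps i)))
weights⇒cone [] w w≥0 = nil
weights⇒cone (p ∷ ps) w w≥0 = cons (w≥0 zero) (weights⇒cone ps (λ i → w (suc i)) (λ i → w≥0 (suc i)))

cone-cong : ∀ {ps t t′ x x′ y y′} → t ≡ t′ → x ≡ x′ → y ≡ y′ → Cone ps t (x , y) → Cone ps t′ (x′ , y′)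
cone-cong refl refl refl c = c

conv⇒cone : ∀ {ps x} → conv ps x → Cone ps 1ℚ x
conv⇒cone {ps} (w , w≥0 , Σ≡1 , Σx , Σy) = cone-cong Σ≡1 Σx Σy (weights⇒cone ps w w≥0)

cone⇒weights : ∀ {ps t x} → Cone ps t x → ∃[ w ] ((∀ i → 0ℚ ≤ w i) × sum w ≡ t ×
  sum (λ i → w i * proj₁ (lookup ps i)) ≡ proj₁ x × sum (λ i → w i * proj₂ (lookup ps i)) ≡ proj₂ x)
cone⇒weights nil = (λ ()) , (λ ()) , refl , refl , refl
cone⇒weights (cons {a = a} 0≤a c) with cone⇒weights c
... | w , w≥0 , refl , refl , refl =
  (λ { zero → a ; (suc i) → w i }) , (λ { zero → 0≤a ; (suc i) → w≥0 i }) , refl , refl , refl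

cone⇒conv : ∀ {ps x} → Cone ps 1ℚ x → conv ps x
cone⇒conv = cone⇒weights

cone-zero : ∀ ps → Cone ps 0ℚ (0ℚ , 0ℚ)
cone-zero [] = nil
cone-zero (p ∷ ps) = cone-cong (+-identityˡ 0ℚ) (go (proj₁ p)) (go (proj₂ p)) (cons ≤-refl (cone-zero ps))
  where
  go : ∀ x → 0ℚ * x + 0ℚ ≡ 0ℚ
  go = solve-∀ ℚ-ring

cone-point : ∀ {p ps} → p ∈ ps → Cone ps 1ℚ p
cone-point {p} (here {xs = ps} refl) =
  cone-cong (+-identityʳ 1ℚ) (go (proj₁ p)) (go (proj₂ p)) (cons (from-yes (0ℚ ≤? 1ℚ)) (cone-zero ps))
  where
  go : ∀ x → 1ℚ * x + 0ℚ ≡ x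
  go = solve-∀ ℚ-ring
cone-point {p} (there {q} i) =
  cone-cong (+-identityˡ 1ℚ) (go (proj₁ q) (proj₁ p)) (go (proj₂ q) (proj₂ p)) (cons ≤-refl (cone-point i))
  where
  go : ∀ x y → 0ℚ * x + y ≡ y
  go = solve-∀ ℚ-ring

cone-vertex : ∀ vs i → Cone (map fromℤ² vs) 1ℚ (fromℤ² (lookup vs i))
cone-vertex vs i = cone-point (∈-map⁺ fromℤ² (∈-lookup {xs = vs} i))

cone-scale : ∀ {ps t x y a} → 0ℚ ≤ a → Cone ps t (x , y) → Cone ps (a * t) (a * x , a * y)
cone-scale {a = a} 0≤a nil = cone-cong (sym (*-zeroʳ a)) (sym (*-zeroʳ a)) (sym (*-zeroʳ a)) nil
cone-scale {a = a} 0≤a (cons {p} {a = b} {t} {x} {y} 0≤b c) =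
  cone-cong (sym (*-distribˡ-+ a b t)) (go a b (proj₁ p) x) (go a b (proj₂ p) y) (cons (0≤a ⊠ 0≤b) (cone-scale 0≤a c))
  where
  go : ∀ a b p x → a * b * p + a * x ≡ a * (b * p + x)
  go = solve-∀ ℚ-ring

cone-add : ∀ {ps t x y t′ x′ y′} → Cone ps t (x , y) → Cone ps t′ (x′ , y′) → Cone ps (t + t′) (x + x′ , y + y′)
cone-add nil nil = nil
cone-add (cons {p} {a = a} {t} {x} {y} 0≤a c) (cons {a = a′} {t′} {x′} {y′} 0≤a′ c′) =
    cone-cong (go₁ a t a′ t′) (go₂ (proj₁ p) a x a′ x′) (go₂ (proj₂ p) a y a′ y′) (cons (0≤a ⊞ 0≤a′) (cone-add c c′))
  where
  go₁ : ∀ a t a′ t′ → a + a′ + (t + t′) ≡ a + t + (a′ + t′)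
  go₁ = solve-∀ ℚ-ring
  go₂ : ∀ p a x a′ x′ → (a + a′) * p + (x + x′) ≡ a * p + x + (a′ * p + x′)
  go₂ = solve-∀ ℚ-ring

affine : ℚ → ℚ → ℚ → ℚ² → ℚ
affine α β γ (x , y) = α * x + β * y + γ

-- Homogenising γ to γ * t makes the inequality linear on the cone, so that it adds up along the
-- list.
cone-half-plane : ∀ {ps t x y} α β γ → All (λ p → 0ℚ ≤ affine α β γ p) ps → Cone ps t (x , y) → 0ℚ ≤ α * x + β * y + γ * t
cone-half-plane α β γ [] nil = ≤-reflexive (go α β γ)
  where
  go : ∀ α β γ → 0ℚ ≡ α * 0ℚ + β * 0ℚ + γ * 0ℚ
  go = solve-∀ ℚ-ring
cone-half-plane α β γ (h ∷ hs) (cons {p} {a = a} {t} {x} {y} 0≤a c) = ≤-trans (0≤a ⊠ h ⊞ cone-half-plane α β γ hs c)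
    (≤-reflexive (go α β γ a (proj₁ p) (proj₂ p) t x y))
  where
  go : ∀ α β γ a p q t x y → a * (α * p + β * q + γ) + (α * x + β * y + γ * t) ≡ α * (a * p + x) + β * (a * q + y) + γ * (a + t)
  go = solve-∀ ℚ-ring

conv-half-plane : ∀ {ps} α β γ → All (λ p → 0ℚ ≤ affine α β γ p) ps → ∀ {x} → conv ps x → 0ℚ ≤ affine α β γ x
conv-half-plane α β γ h {x , y} c =
  subst (λ z → 0ℚ ≤ α * x + β * y + z) (*-identityʳ γ) (cone-half-plane α β γ h (conv⇒cone c))

image-affine : ∀ φ α β γ x → let open AffineUnimodular φ using (a; b; c; d; e; f) in
  affine α β γ (apply φ x) ≡ affine (α * fromℤ a + β * fromℤ c) (α * fromℤ b + β * fromℤ d) (α * fromℤ e + β * fromℤ f + γ) x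
image-affine φ α β γ (x , y) = go α β γ (fromℤ a) (fromℤ b) (fromℤ c) (fromℤ d) (fromℤ e) (fromℤ f) x y
  where
  open AffineUnimodular φ using (a; b; c; d; e; f)
  go : ∀ α β γ a b c d e f x y →
    α * (a * x + b * y + e) + β * (c * x + d * y + f) + γ ≡ (α * a + β * c) * x + (α * b + β * d) * y + (α * e + β * f + γ)
  go = solve-∀ ℚ-ring

all-vertices : ∀ {P : ℚ² → Set} vs → (∀ i → P (fromℤ² (lookup vs i))) → All P (map fromℤ² vs)
all-vertices [] h = []
all-vertices (v ∷ vs) h = h zero ∷ all-vertices vs (λ i → h (suc i))

image-half-plane : ∀ φ vs α β γ → (∀ i → 0ℚ ≤ affine α β γ (fromℤ² (applyℤ φ (lookup vs i)))) →
  ∀ {y} → image (apply φ) (conv (map fromℤ² vs)) y → 0ℚ ≤ affine α β γ y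
image-half-plane φ vs α β γ h (x , c , refl) = subst (0ℚ ≤_) (sym (image-affine φ α β γ x))
  (conv-half-plane (α * fromℤ a + β * fromℤ c′) (α * fromℤ b + β * fromℤ d) (α * fromℤ e + β * fromℤ f + γ) (all-vertices vs (λ i → subst (0ℚ ≤_)
    (trans (cong (affine α β γ) (sym (apply-fromℤ² φ (lookup vs i)))) (image-affine φ α β γ (fromℤ² (lookup vs i)))) (h i))) c)
  where
  open AffineUnimodular φ using (a; b; d; e; f) renaming (c to c′)

-- A convex combination of image points is the image of the same combination of their preimages.
hull-in-image : ∀ φ ps {ts} → All (image (apply φ) (conv ps)) ts → ∀ {x} → conv ts x → image (apply φ) (conv ps) x
hull-in-image φ ps hs c with lift hs (conv⇒cone c)
  where
  open AffineUnimodular φ using (a; b; d; e; f) renaming (c to c′)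
  -- At total weight t the translation part is scaled by t as well; height one recovers φ.
  lift : ∀ {ts t x y} → All (image (apply φ) (conv ps)) ts → Cone ts t (x , y) → ∃[ x′ ] ∃[ y′ ] (Cone ps t (x′ , y′) ×
    fromℤ a * x′ + fromℤ b * y′ + fromℤ e * t ≡ x × fromℤ c′ * x′ + fromℤ d * y′ + fromℤ f * t ≡ y)
  lift [] nil = 0ℚ , 0ℚ , cone-zero ps , go (fromℤ a) (fromℤ b) (fromℤ e) , go (fromℤ c′) (fromℤ d) (fromℤ f)
    where
    go : ∀ a b e → a * 0ℚ + b * 0ℚ + e * 0ℚ ≡ 0ℚ
    go = solve-∀ ℚ-ring
  lift (((u , v) , h , refl) ∷ hs) (cons {a = k} {t} 0≤k c) with lift hs c
  ... | x′ , y′ , c″ , refl , refl =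
    k * u + x′ , k * v + y′ ,
    cone-cong (cong (_+ t) (*-identityʳ k)) refl refl (cone-add (cone-scale 0≤k (conv⇒cone h)) c″) ,
    go (fromℤ a) (fromℤ b) (fromℤ e) k u v t x′ y′ , go (fromℤ c′) (fromℤ d) (fromℤ f) k u v t x′ y′
    where
    go : ∀ a b e k u v t x y → a * (k * u + x) + b * (k * v + y) + e * (k + t)
      ≡ k * (a * u + b * v + e) + (a * x + b * y + e * t)
    go = solve-∀ ℚ-ring
... | x′ , y′ , c″ , refl , refl = (x′ , y′) , cone⇒conv c″ ,
  cong₂ _,_ (cong (_+_ (fromℤ a * x′ + fromℤ b * y′)) (sym (*-identityʳ (fromℤ e))))
            (cong (_+_ (fromℤ c′ * x′ + fromℤ d * y′)) (sym (*-identityʳ (fromℤ f))))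
  where open AffineUnimodular φ using (a; b; d; e; f) renaming (c to c′)

-- Points of the target regions, described by inequalities

module _ {l : ℚ} (0<l : 0ℚ < l) where

  private
    instance
      l-pos : Positive l
      l-pos = positive 0<l
      l-nonZero : NonZero l
      l-nonZero = pos⇒nonZero l

    r : ℚ
    r = 1/ l

    0≤r : 0ℚ ≤ r
    0≤r = <⇒≤ (positive⁻¹ r {{1/pos⇒pos l}})

    l*r : l * r ≡ 1ℚ
    l*r = *-inverseʳ l

  -- The weights are barycentric coordinates: each edge functional divided by its value l at the
  -- opposite corner of the dilate.
  Δ-complete : ∀ {x y} → 0ℚ ≤ x → 0ℚ ≤ y → x + y ≤ l → (l · Δ) (x , y)
  Δ-complete {x} {y} 0≤x 0≤y x+y≤l = (r * x , r * y) ,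
    ( (λ { zero → r * (l - (x + y)) ; (suc zero) → r * x ; (suc (suc zero)) → r * y })
    , (λ { zero → 0≤r ⊠ p≤q⇒0≤q-p x+y≤l ; (suc zero) → 0≤r ⊠ 0≤x ; (suc (suc zero)) → 0≤r ⊠ 0≤y })
    , trans (go₁ r l x y) l*r , go₂ (r * (l - (x + y))) (r * x) (r * y) , go₃ (r * (l - (x + y))) (r * x) (r * y)) ,
    cong₂ _,_ (cancel x) (cancel y)
    where
    go₁ : ∀ r l x y → r * (l - (x + y)) + (r * x + (r * y + 0ℚ)) ≡ l * r
    go₁ = solve-∀ ℚ-ring
    go₂ : ∀ u v w → u * 0ℚ + (v * 1ℚ + (w * 0ℚ + 0ℚ)) ≡ v
    go₂ = solve-∀ ℚ-ring
    go₃ : ∀ u v w → u * 0ℚ + (v * 0ℚ + (w * 1ℚ + 0ℚ)) ≡ w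
    go₃ = solve-∀ ℚ-ring
    cancel : ∀ x → l * (r * x) ≡ x
    cancel x = trans (sym (*-assoc l r x)) (trans (cong (_* x) l*r) (*-identityˡ x))

  thin-complete : ∀ {x y} → 0ℚ ≤ x → 0ℚ ≤ y → x + l * y ≤ l → thinTriangle l (x , y)
  thin-complete {x} {y} 0≤x 0≤y h =
    (λ { zero → r * (l - (x + l * y)) ; (suc zero) → r * x ; (suc (suc zero)) → y }) ,
    (λ { zero → 0≤r ⊠ p≤q⇒0≤q-p h ; (suc zero) → 0≤r ⊠ 0≤x ; (suc (suc zero)) → 0≤y }) ,
    trans (go₁ r l x y) (trans (cong (λ t → t - t * y + y) l*r) (go₄ y)) ,
    trans (go₂ r l x y) (trans (cong (_* x) l*r) (*-identityˡ x)) , go₃ (r * (l - (x + l * y))) (r * x) y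
    where
    go₁ : ∀ r l x y → r * (l - (x + l * y)) + (r * x + (y + 0ℚ)) ≡ l * r - l * r * y + y
    go₁ = solve-∀ ℚ-ring
    go₂ : ∀ r l x y → r * (l - (x + l * y)) * 0ℚ + (r * x * l + (y * 0ℚ + 0ℚ)) ≡ l * r * x
    go₂ = solve-∀ ℚ-ring
    go₃ : ∀ u v w → u * 0ℚ + (v * 0ℚ + (w * 1ℚ + 0ℚ)) ≡ w
    go₃ = solve-∀ ℚ-ring
    go₄ : ∀ y → 1ℚ - 1ℚ * y + y ≡ 1ℚ
    go₄ = solve-∀ ℚ-ring

corners : List ℚ²
corners = (0ℚ , 0ℚ) ∷ (1ℚ , 0ℚ) ∷ (0ℚ , 1ℚ) ∷ (1ℚ , 1ℚ) ∷ []

-- Bilinear weights, the products of the barycentric coordinates of the two unit intervals.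
square⊆corners : ∀ {p} → unitSquare p → conv corners p
square⊆corners {x , y} ((0≤x , x≤1) , (0≤y , y≤1)) =
  (λ { zero → (1ℚ - x) * (1ℚ - y) ; (suc zero) → x * (1ℚ - y)
     ; (suc (suc zero)) → (1ℚ - x) * y ; (suc (suc (suc zero))) → x * y }) ,
  (λ { zero → p≤q⇒0≤q-p x≤1 ⊠ p≤q⇒0≤q-p y≤1 ; (suc zero) → 0≤x ⊠ p≤q⇒0≤q-p y≤1
     ; (suc (suc zero)) → p≤q⇒0≤q-p x≤1 ⊠ 0≤y ; (suc (suc (suc zero))) → 0≤x ⊠ 0≤y }) ,
  go₁ x y , go₂ x y , go₃ x y
  where
  go₁ : ∀ x y → (1ℚ - x) * (1ℚ - y) + (x * (1ℚ - y) + ((1ℚ - x) * y + (x * y + 0ℚ))) ≡ 1ℚ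
  go₁ = solve-∀ ℚ-ring
  go₂ : ∀ x y → (1ℚ - x) * (1ℚ - y) * 0ℚ + (x * (1ℚ - y) * 1ℚ + ((1ℚ - x) * y * 0ℚ + (x * y * 1ℚ + 0ℚ))) ≡ x
  go₂ = solve-∀ ℚ-ring
  go₃ : ∀ x y → (1ℚ - x) * (1ℚ - y) * 0ℚ + (x * (1ℚ - y) * 0ℚ + ((1ℚ - x) * y * 1ℚ + (x * y * 1ℚ + 0ℚ))) ≡ y
  go₃ = solve-∀ ℚ-ring

⅓ : ℚ
⅓ = 1/ 3ℚ

-- Each edge functional takes the value 3 at the opposite vertex, hence the factor `⅓` in the
-- barycentric coordinates.
triangle₁₂-complete : ∀ {x y} → x ≤ 2ℚ * y → y ≤ 2ℚ * x → x + y ≤ 3ℚ → triangle₁₂ (x , y)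
triangle₁₂-complete {x} {y} h₁ h₂ h₃ =
  (λ { zero → ⅓ * (3ℚ - (x + y)) ; (suc zero) → ⅓ * (2ℚ * y - x) ; (suc (suc zero)) → ⅓ * (2ℚ * x - y) }) ,
  (λ { zero → 0≤⅓ ⊠ p≤q⇒0≤q-p h₃ ; (suc zero) → 0≤⅓ ⊠ p≤q⇒0≤q-p h₁ ; (suc (suc zero)) → 0≤⅓ ⊠ p≤q⇒0≤q-p h₂ }) ,
  go₁ x y , go₂ x y , go₃ x y
  where
  0≤⅓ : 0ℚ ≤ ⅓
  0≤⅓ = from-yes (0ℚ ≤? ⅓)
  go₁ : ∀ x y → ⅓ * (3ℚ - (x + y)) + (⅓ * (2ℚ * y - x) + (⅓ * (2ℚ * x - y) + 0ℚ)) ≡ 1ℚ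
  go₁ = solve-∀ ℚ-ring
  go₂ : ∀ x y → ⅓ * (3ℚ - (x + y)) * 0ℚ + (⅓ * (2ℚ * y - x) * 1ℚ + (⅓ * (2ℚ * x - y) * 2ℚ + 0ℚ)) ≡ x
  go₂ = solve-∀ ℚ-ring
  go₃ : ∀ x y → ⅓ * (3ℚ - (x + y)) * 0ℚ + (⅓ * (2ℚ * y - x) * 2ℚ + (⅓ * (2ℚ * x - y) * 1ℚ + 0ℚ)) ≡ y
  go₃ = solve-∀ ℚ-ring

module _ (φ : AffineUnimodular) (vs : List ℤ²) where

  private
    S : Region
    S = image (apply φ) (conv (map fromℤ² vs))
    W : Points (length vs)
    W i = applyℤ φ (lookup vs i)

  integral-half-plane : ∀ α β γ → (∀ i → α ℤ.* proj₁ (W i) ℤ.+ β ℤ.* proj₂ (W i) ℤ.≤ γ) →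
    ∀ {x y} → S (x , y) → fromℤ α * x + fromℤ β * y ≤ fromℤ γ
  integral-half-plane α β γ h {x} {y} s = 0≤q-p⇒p≤q (subst (0ℚ ≤_) (go (fromℤ α) (fromℤ β) (fromℤ γ) x y)
    (image-half-plane φ vs (- fromℤ α) (- fromℤ β) (fromℤ γ) vertex s))
    where
    go : ∀ α β γ x y → (- α) * x + (- β) * y + γ ≡ γ - (α * x + β * y)
    go = solve-∀ ℚ-ring
    vertex : ∀ i → 0ℚ ≤ affine (- fromℤ α) (- fromℤ β) (fromℤ γ) (fromℤ² (W i))
    vertex i = subst (0ℚ ≤_) (sym (trans (go (fromℤ α) (fromℤ β) (fromℤ γ) (fromℤ x′) (fromℤ y′))
        (cong (λ t → fromℤ γ - t) (sym (trans (fromℤ-+ (α ℤ.* x′) (β ℤ.* y′)) (cong₂ _+_ (fromℤ-* α x′) (fromℤ-* β y′)))))))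
      (p≤q⇒0≤q-p (fromℤ-mono-≤ (h i)))
      where
      x′ = proj₁ (W i)
      y′ = proj₂ (W i)

  0≤x-plane : (∀ i → 0ℤ ℤ.≤ proj₁ (W i)) → ∀ {x y} → S (x , y) → 0ℚ ≤ x
  0≤x-plane h {x} {y} s = 0≤q-p⇒p≤q (subst (0ℚ ≤_) (go x y)
    (p≤q⇒0≤q-p (integral-half-plane -1ℤ 0ℤ 0ℤ (λ i → certify (h i) (goℤ (proj₁ (W i)) (proj₂ (W i)))) s)))
    where
    go : ∀ x y → 0ℚ - (- 1ℚ * x + 0ℚ * y) ≡ x - 0ℚ
    go = solve-∀ ℚ-ring
    goℤ : ∀ x y → x ≡ 0ℤ ℤ.- (-1ℤ ℤ.* x ℤ.+ 0ℤ ℤ.* y)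
    goℤ = ℤ.solve-∀

  0≤y-plane : (∀ i → 0ℤ ℤ.≤ proj₂ (W i)) → ∀ {x y} → S (x , y) → 0ℚ ≤ y
  0≤y-plane h {x} {y} s = 0≤q-p⇒p≤q (subst (0ℚ ≤_) (go x y)
    (p≤q⇒0≤q-p (integral-half-plane 0ℤ -1ℤ 0ℤ (λ i → certify (h i) (goℤ (proj₁ (W i)) (proj₂ (W i)))) s)))
    where
    go : ∀ x y → 0ℚ - (0ℚ * x + - 1ℚ * y) ≡ y - 0ℚ
    go = solve-∀ ℚ-ring
    goℤ : ∀ x y → y ≡ 0ℤ ℤ.- (0ℤ ℤ.* x ℤ.+ -1ℤ ℤ.* y)
    goℤ = ℤ.solve-∀

  skew-plane : ∀ k l → (∀ i → proj₁ (W i) ℤ.+ k ℤ.* proj₂ (W i) ℤ.≤ l) → ∀ {x y} → S (x , y) → x + fromℤ k * y ≤ fromℤ l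
  skew-plane k l h {x} {y} s = subst (λ t → t + fromℤ k * y ≤ fromℤ l) (*-identityˡ x)
    (integral-half-plane 1ℤ k l (λ i → subst (λ t → t ℤ.+ k ℤ.* proj₂ (W i) ℤ.≤ l) (sym (ℤ.*-identityˡ (proj₁ (W i)))) (h i)) s)

  in-thin : ∀ k l → (∀ i → InTriangle k l (W i)) → ∀ {x y} → S (x , y) → 0ℚ ≤ x × 0ℚ ≤ y × x + fromℤ k * y ≤ fromℤ l
  in-thin k l h s = 0≤x-plane (λ i → proj₁ (h i)) s , 0≤y-plane (λ i → proj₁ (proj₂ (h i))) s ,
    skew-plane k l (λ i → proj₂ (proj₂ (h i))) s

  fits-Δ : ∀ {l} → 1ℤ ℤ.≤ l → (∀ i → InTriangle 1ℤ l (W i)) → FitsIn (conv (map fromℤ² vs)) (fromℤ l · Δ)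
  fits-Δ {l} 1≤l h = φ , λ {p} s → let 0≤x , 0≤y , x+y≤l = in-thin 1ℤ l h s in
    Δ-complete (<-≤-trans (from-yes (0ℚ <? 1ℚ)) (fromℤ-mono-≤ 1≤l)) 0≤x 0≤y
      (subst (λ t → proj₁ p + t ≤ fromℤ l) (*-identityˡ (proj₂ p)) x+y≤l)

  private
    at : ∀ i {v} → W i ≡ v → S (fromℤ² v)
    at i refl = fromℤ² (lookup vs i) , cone⇒conv (cone-vertex vs i) , apply-fromℤ² φ (lookup vs i)

  ≃-thin : ∀ {l} → 1ℤ ℤ.≤ l → (∀ i → InTriangle l l (W i)) → ∀ {o p q} →
    W o ≡ (0ℤ , 0ℤ) → W p ≡ (l , 0ℤ) → W q ≡ (0ℤ , 1ℤ) → conv (map fromℤ² vs) ≃ₗ thinTriangle (fromℤ l)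
  ≃-thin {l} 1≤l h {o} {p} {q} Wo Wp Wq = φ ,
    (λ s → let 0≤x , 0≤y , x+ly≤l = in-thin l l h s in
      thin-complete (<-≤-trans (from-yes (0ℚ <? 1ℚ)) (fromℤ-mono-≤ 1≤l)) 0≤x 0≤y x+ly≤l) ,
    hull-in-image φ (map fromℤ² vs) (at o Wo ∷ at p Wp ∷ at q Wq ∷ [])

  ≃-square : (∀ i → InSquare (W i)) → ∀ {o p q r} → W o ≡ (0ℤ , 0ℤ) → W p ≡ (1ℤ , 0ℤ) → W q ≡ (0ℤ , 1ℤ) → W r ≡ (1ℤ , 1ℤ) →
    conv (map fromℤ² vs) ≃ₗ unitSquare
  ≃-square h {o} {p} {q} {r} Wo Wp Wq Wr = φ ,
    (λ s → (0≤x-plane (λ i → proj₁ (proj₁ (h i))) s , x≤1 s) , (0≤y-plane (λ i → proj₁ (proj₂ (h i))) s , y≤1 s)) ,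
    (λ u → hull-in-image φ (map fromℤ² vs) (at o Wo ∷ at p Wp ∷ at q Wq ∷ at r Wr ∷ []) (square⊆corners u))
    where
    x≤1 : ∀ {x y} → S (x , y) → x ≤ 1ℚ
    x≤1 {x} {y} s = subst (_≤ 1ℚ) (go x y)
      (integral-half-plane 1ℤ 0ℤ 1ℤ (λ i → ℤ.≤-trans (ℤ.≤-reflexive (goℤ (proj₁ (W i)) (proj₂ (W i)))) (proj₂ (proj₁ (h i)))) s)
      where
      go : ∀ x y → 1ℚ * x + 0ℚ * y ≡ x
      go = solve-∀ ℚ-ring
      goℤ : ∀ x y → 1ℤ ℤ.* x ℤ.+ 0ℤ ℤ.* y ≡ x
      goℤ = ℤ.solve-∀
    y≤1 : ∀ {x y} → S (x , y) → y ≤ 1ℚ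
    y≤1 {x} {y} s = subst (_≤ 1ℚ) (go x y)
      (integral-half-plane 0ℤ 1ℤ 1ℤ (λ i → ℤ.≤-trans (ℤ.≤-reflexive (goℤ (proj₁ (W i)) (proj₂ (W i)))) (proj₂ (proj₂ (h i)))) s)
      where
      go : ∀ x y → 0ℚ * x + 1ℚ * y ≡ y
      go = solve-∀ ℚ-ring
      goℤ : ∀ x y → 0ℤ ℤ.* x ℤ.+ 1ℤ ℤ.* y ≡ y
      goℤ = ℤ.solve-∀

  ≃-triangle₁₂ : (∀ i → InTriangle₁₂ (W i)) → ∀ {o p q} → W o ≡ (0ℤ , 0ℤ) → W p ≡ (1ℤ , + 2) → W q ≡ (+ 2 , 1ℤ) →
    conv (map fromℤ² vs) ≃ₗ triangle₁₂
  ≃-triangle₁₂ h {o} {p} {q} Wo Wp Wq = φ ,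
    (λ s → triangle₁₂-complete (h₁ s) (h₂ s) (h₃ s)) ,
    hull-in-image φ (map fromℤ² vs) (at o Wo ∷ at p Wp ∷ at q Wq ∷ [])
    where
    h₁ : ∀ {x y} → S (x , y) → x ≤ 2ℚ * y
    h₁ {x} {y} s = 0≤q-p⇒p≤q (subst (0ℚ ≤_) (go x y) (p≤q⇒0≤q-p
      (integral-half-plane 1ℤ (ℤ.- (+ 2)) 0ℤ (λ i → certify (gap (proj₁ (h i))) (goℤ (proj₁ (W i)) (proj₂ (W i)))) s)))
      where
      go : ∀ x y → 0ℚ - (1ℚ * x + - 2ℚ * y) ≡ 2ℚ * y - x
      go = solve-∀ ℚ-ring
      goℤ : ∀ x y → + 2 ℤ.* y ℤ.- x ≡ 0ℤ ℤ.- (1ℤ ℤ.* x ℤ.+ (ℤ.- (+ 2)) ℤ.* y)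
      goℤ = ℤ.solve-∀
    h₂ : ∀ {x y} → S (x , y) → y ≤ 2ℚ * x
    h₂ {x} {y} s = 0≤q-p⇒p≤q (subst (0ℚ ≤_) (go x y) (p≤q⇒0≤q-p
      (integral-half-plane (ℤ.- (+ 2)) 1ℤ 0ℤ (λ i → certify (gap (proj₁ (proj₂ (h i)))) (goℤ (proj₁ (W i)) (proj₂ (W i)))) s)))
      where
      go : ∀ x y → 0ℚ - (- 2ℚ * x + 1ℚ * y) ≡ 2ℚ * x - y
      go = solve-∀ ℚ-ring
      goℤ : ∀ x y → + 2 ℤ.* x ℤ.- y ≡ 0ℤ ℤ.- ((ℤ.- (+ 2)) ℤ.* x ℤ.+ 1ℤ ℤ.* y)
      goℤ = ℤ.solve-∀
    h₃ : ∀ {x y} → S (x , y) → x + y ≤ 3ℚ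
    h₃ {x} {y} s = subst (λ t → x + t ≤ 3ℚ) (*-identityˡ y)
      (skew-plane 1ℤ (+ 3) (λ i → subst (λ t → proj₁ (W i) ℤ.+ t ℤ.≤ + 3) (sym (ℤ.*-identityˡ (proj₂ (W i)))) (proj₂ (proj₂ (h i)))) s)

-- The inequality and the shapes attaining it

outcome : ∀ vs → TurnsLeft vs → twiceArea vs ≢ 0ℤ → Outcome (lookup vs) (twiceArea vs)
outcome [] ccw D≢0 = contradiction refl D≢0
outcome (o ∷ []) ccw D≢0 = contradiction (twiceArea-fan o []) D≢0
outcome (o ∷ p ∷ []) ccw D≢0 = contradiction (twiceArea-fan o (p ∷ [])) D≢0
outcome vs@(_ ∷ _ ∷ _ ∷ _) ccw D≢0 = classify (lookup vs) (twiceArea vs) (polygon-bound vs ccw)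
  (λ col → ℤ.<-irrefl (sym (col 0F 1F 0F 2F)) (ccw {0F} {1F} {2F} z<s (s<s z<s)))

thin⇒Δ : ∀ {l v} → 1ℤ ℤ.≤ l → InTriangle l l v → InTriangle 1ℤ l v
thin⇒Δ {l} {x , y} 1≤l (0≤x , 0≤y , h) =
  0≤x , 0≤y , ℤ.≤-trans (ℤ.+-monoʳ-≤ x (ℤ.*-monoʳ-≤-nonNeg y {{ℤ.nonNegative 0≤y}} 1≤l)) h

square⇒Δ : ∀ {v} → InSquare v → InTriangle 1ℤ (+ 2) v
square⇒Δ {x , y} ((0≤x , x≤1) , (0≤y , y≤1)) =
  0≤x , 0≤y , ℤ.+-mono-≤ x≤1 (subst (ℤ._≤ 1ℤ) (sym (ℤ.*-identityˡ y)) y≤1)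

triangle₁₂⇒Δ : ∀ {v} → InTriangle₁₂ v → InTriangle 1ℤ (+ 3) v
triangle₁₂⇒Δ {x , y} (h₁ , h₂ , h₃) =
  third h₁ h₂ , third h₂ h₁ , subst (λ t → x ℤ.+ t ℤ.≤ + 3) (sym (ℤ.*-identityˡ y)) h₃

ls≤twiceArea : ∀ {vs D l} → Outcome (lookup vs) D → IsLsΔ (conv (map fromℤ² vs)) l → l ≤ fromℤ D
ls≤twiceArea {vs} {D} {l} out ls = go out
  where
  open IsLsΔ ls
  bounded : ∀ {m} φ → 1ℤ ℤ.≤ m → (∀ i → InTriangle 1ℤ m (applyℤ φ (lookup vs i))) → l ≤ fromℤ m
  bounded {m} φ 1≤m h = minimal (fromℤ m) (fromℤ-mono-≤ (ℤ.≤-trans (from-yes (0ℤ ℤ.≤? 1ℤ)) 1≤m)) (fits-Δ φ vs 1≤m h)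
  go : Outcome (lookup vs) D → l ≤ fromℤ D
  go (smaller φ 2≤D h) = ≤-trans (bounded φ (ℤ.+-monoˡ-≤ -1ℤ 2≤D) h) (fromℤ-mono-≤ (ℤ.i-j≤i D 1ℤ))
  go (thin φ 1≤D h _ _ _ _ _ _) = bounded φ 1≤D (λ i → thin⇒Δ 1≤D (h i))
  go (square φ refl h _ _ _ _ _ _ _ _) = bounded φ (from-yes (1ℤ ℤ.≤? + 2)) (λ i → square⇒Δ (h i))
  go (triangle φ refl h _ _ _ _ _ _) = bounded φ (from-yes (1ℤ ℤ.≤? + 3)) (λ i → triangle₁₂⇒Δ (h i))

-- Minimality of l = D rules out `smaller`, which would give D ≤ D - 1.
optimal-shape : ∀ {vs D l} → Outcome (lookup vs) D → IsLsΔ (conv (map fromℤ² vs)) l → l ≡ fromℤ D → let S = conv (map fromℤ² vs) in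
  (1ℚ ≤ l × S ≃ₗ thinTriangle l) ⊎ (l ≡ 2ℚ × S ≃ₗ unitSquare) ⊎ (l ≡ 3ℚ × S ≃ₗ triangle₁₂)
optimal-shape {vs} {D} (smaller φ 2≤D h) ls refl = contradiction
  (fromℤ-cancel-≤ (IsLsΔ.minimal ls (fromℤ (D ℤ.- 1ℤ)) (fromℤ-mono-≤ (ℤ.≤-trans (from-yes (0ℤ ℤ.≤? 1ℤ)) 1≤D-1)) (fits-Δ φ vs 1≤D-1 h)))
  (ℤ.<⇒≱ (ℤ.suc[i]≤j⇒i<j (ℤ.≤-reflexive (id D))))
  where
  1≤D-1 : 1ℤ ℤ.≤ D ℤ.- 1ℤ
  1≤D-1 = ℤ.+-monoˡ-≤ -1ℤ 2≤D
  id : ∀ D → 1ℤ ℤ.+ (D ℤ.- 1ℤ) ≡ D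
  id = ℤ.solve-∀
optimal-shape {vs} (thin φ 1≤D h o p q Vo Vp Vq) ls refl = inj₁ (fromℤ-mono-≤ 1≤D , ≃-thin φ vs 1≤D h Vo Vp Vq)
optimal-shape {vs} (square φ refl h o p q r Vo Vp Vq Vr) ls refl = inj₂ (inj₁ (refl , ≃-square φ vs h Vo Vp Vq Vr))
optimal-shape {vs} (triangle φ refl h o p q Vo Vp Vq) ls refl = inj₂ (inj₂ (refl , ≃-triangle₁₂ φ vs h Vo Vp Vq))

-- Areas of polygons inside the target regions

vertex-image : ∀ φ vs {T : Region} → image (apply φ) (conv (map fromℤ² vs)) ⊆ T → ∀ i → T (fromℤ² (applyℤ φ (lookup vs i)))
vertex-image φ vs S⊆T i = S⊆T (fromℤ² (lookup vs i) , cone⇒conv (cone-vertex vs i) , apply-fromℤ² φ (lookup vs i))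

integral : ∀ α β γ x y → 0ℚ ≤ affine (fromℤ α) (fromℤ β) (fromℤ γ) (fromℤ² (x , y)) → 0ℤ ℤ.≤ α ℤ.* x ℤ.+ β ℤ.* y ℤ.+ γ
integral α β γ x y h = fromℤ-cancel-≤ (subst (0ℚ ≤_) (sym (fromℤ-affine α β γ x y)) h)

square-twiceArea : ∀ vs → TurnsLeft vs → conv (map fromℤ² vs) ≃ₗ unitSquare → fromℤ (twiceArea vs) ≤ 2ℚ
square-twiceArea vs ccw (φ , S⊆T , _) = fromℤ-mono-≤ (square-area φ vs ccw λ i →
  let (0≤x , x≤1) , (0≤y , y≤1) = vertex-image φ vs {unitSquare} S⊆T i in
  inSquare⇒∈ ((fromℤ-cancel-≤ 0≤x , fromℤ-cancel-≤ x≤1) , (fromℤ-cancel-≤ 0≤y , fromℤ-cancel-≤ y≤1)))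

triangle-twiceArea : ∀ vs → TurnsLeft vs → conv (map fromℤ² vs) ≃ₗ triangle₁₂ → fromℤ (twiceArea vs) ≤ 3ℚ
triangle-twiceArea vs ccw (φ , S⊆T , _) = fromℤ-mono-≤ (triangle-area φ vs ccw λ i →
  inTriangle₁₂⇒∈ (inside i))
  where
  0≤ : ∀ {p} → {{_ : NonNegative p}} → 0ℚ ≤ p
  0≤ {p} = nonNegative⁻¹ p
  inside : ∀ i → InTriangle₁₂ (applyℤ φ (lookup vs i))
  inside i =
    certify (integral -1ℤ (+ 2) 0ℤ x y (conv-half-plane (fromℤ -1ℤ) 2ℚ 0ℚ (0≤ ∷ 0≤ ∷ 0≤ ∷ []) t)) (id₁ x y) ,
    certify (integral (+ 2) -1ℤ 0ℤ x y (conv-half-plane 2ℚ (fromℤ -1ℤ) 0ℚ (0≤ ∷ 0≤ ∷ 0≤ ∷ []) t)) (id₂ x y) ,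
    certify (integral -1ℤ -1ℤ (+ 3) x y (conv-half-plane (fromℤ -1ℤ) (fromℤ -1ℤ) 3ℚ (0≤ ∷ 0≤ ∷ 0≤ ∷ []) t)) (id₃ x y)
    where
    x = proj₁ (applyℤ φ (lookup vs i))
    y = proj₂ (applyℤ φ (lookup vs i))
    t = vertex-image φ vs {triangle₁₂} S⊆T i
    id₁ : ∀ x y → -1ℤ ℤ.* x ℤ.+ + 2 ℤ.* y ℤ.+ 0ℤ ≡ + 2 ℤ.* y ℤ.- x
    id₁ = ℤ.solve-∀
    id₂ : ∀ x y → + 2 ℤ.* x ℤ.+ -1ℤ ℤ.* y ℤ.+ 0ℤ ≡ + 2 ℤ.* x ℤ.- y
    id₂ = ℤ.solve-∀
    id₃ : ∀ x y → -1ℤ ℤ.* x ℤ.+ -1ℤ ℤ.* y ℤ.+ + 3 ≡ + 3 ℤ.- (x ℤ.+ y)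
    id₃ = ℤ.solve-∀

-- The thin triangle has height one, so its lattice points are those on the base and the apex. Here
-- l is an arbitrary rational, hence the comparison in ℚ.
data ThinPoint (l : ℚ) : ℤ² → Set where
  base : ∀ {x} → 0ℤ ℤ.≤ x → fromℤ x ≤ l → ThinPoint l (x , 0ℤ)
  apex : ThinPoint l (0ℤ , 1ℤ)

turn-bases : ∀ a b c → turn (a , 0ℤ) (b , 0ℤ) (c , 0ℤ) ≡ 0ℤ
turn-bases = go
  where
  go : ∀ a b c → (b ℤ.- a) ℤ.* (0ℤ ℤ.- 0ℤ) ℤ.- (0ℤ ℤ.- 0ℤ) ℤ.* (c ℤ.- a) ≡ 0ℤ
  go = ℤ.solve-∀

turn-aba : ∀ a b → turn a b a ≡ 0ℤ
turn-aba (ax , ay) (bx , by) = go ax ay bx by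
  where
  go : ∀ ax ay bx by → (bx ℤ.- ax) ℤ.* (ay ℤ.- ay) ℤ.- (by ℤ.- ay) ℤ.* (ax ℤ.- ax) ≡ 0ℤ
  go = ℤ.solve-∀

-- Only the apex with two base points can span a nonzero area, and at height one twice this area is
-- the distance of the base points.
thin-turn : ∀ {l a b c} → 0ℚ ≤ l → ThinPoint l a → ThinPoint l b → ThinPoint l c → fromℤ (turn a b c) ≤ l
thin-turn {l} 0≤l = go
  where
  flat : ∀ {t} → t ≡ 0ℤ → fromℤ t ≤ l
  flat refl = 0≤l
  below : ∀ {t x y} → 0ℤ ℤ.≤ x → fromℤ y ≤ l → t ≡ y ℤ.- x → fromℤ t ≤ l
  below {x = x} {y} 0≤x y≤l refl = ≤-trans (fromℤ-mono-≤ (ℤ.i-j≤i y x {{ℤ.nonNegative 0≤x}})) y≤l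
  id₁ : ∀ b c → (b ℤ.- 0ℤ) ℤ.* (0ℤ ℤ.- 1ℤ) ℤ.- (0ℤ ℤ.- 1ℤ) ℤ.* (c ℤ.- 0ℤ) ≡ c ℤ.- b
  id₁ = ℤ.solve-∀
  id₂ : ∀ a c → (0ℤ ℤ.- a) ℤ.* (0ℤ ℤ.- 0ℤ) ℤ.- (1ℤ ℤ.- 0ℤ) ℤ.* (c ℤ.- a) ≡ a ℤ.- c
  id₂ = ℤ.solve-∀
  id₃ : ∀ a b → (b ℤ.- a) ℤ.* (1ℤ ℤ.- 0ℤ) ℤ.- (0ℤ ℤ.- 0ℤ) ℤ.* (0ℤ ℤ.- a) ≡ b ℤ.- a
  id₃ = ℤ.solve-∀
  go : ∀ {a b c} → ThinPoint l a → ThinPoint l b → ThinPoint l c → fromℤ (turn a b c) ≤ l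
  go (base {a} _ _) (base {b} _ _) (base {c} _ _) = flat (turn-bases a b c)
  go apex (base {b} 0≤b _) (base {c} _ c≤l) = below 0≤b c≤l (id₁ b c)
  go (base {a} _ a≤l) apex (base {c} 0≤c _) = below 0≤c a≤l (id₂ a c)
  go (base {a} 0≤a _) (base {b} _ b≤l) apex = below 0≤a b≤l (id₃ a b)
  go {c = c} apex apex _ = flat (turn-aab (0ℤ , 1ℤ) c)
  go {b = b} apex _ apex = flat (turn-aba (0ℤ , 1ℤ) b)
  go {a} _ apex apex = flat (turn-abb a (0ℤ , 1ℤ))

-- Either three of the four points lie on the base, or the apex occurs twice.
thin-four : ∀ {l a b c d} → ThinPoint l a → ThinPoint l b → ThinPoint l c → ThinPoint l d →
  turn a b c ≡ 0ℤ ⊎ turn a b d ≡ 0ℤ ⊎ turn a c d ≡ 0ℤ ⊎ turn b c d ≡ 0ℤ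
thin-four (base {a} _ _) (base {b} _ _) (base {c} _ _) d = inj₁ (turn-bases a b c)
thin-four {c = c} apex apex _ _ = inj₁ (turn-aab (0ℤ , 1ℤ) c)
thin-four {b = b} apex (base _ _) apex _ = inj₁ (turn-aba (0ℤ , 1ℤ) b)
thin-four {a = a} (base _ _) apex apex _ = inj₁ (turn-abb a (0ℤ , 1ℤ))
thin-four {b = b} apex (base _ _) (base _ _) apex = inj₂ (inj₁ (turn-aba (0ℤ , 1ℤ) b))
thin-four apex (base {b} _ _) (base {c} _ _) (base {d} _ _) = inj₂ (inj₂ (inj₂ (turn-bases b c d)))
thin-four {a = a} (base _ _) apex (base _ _) apex = inj₂ (inj₁ (turn-abb a (0ℤ , 1ℤ)))
thin-four (base {a} _ _) apex (base {c} _ _) (base {d} _ _) = inj₂ (inj₂ (inj₁ (turn-bases a c d)))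
thin-four {a = a} (base _ _) (base _ _) apex apex = inj₂ (inj₂ (inj₁ (turn-abb a (0ℤ , 1ℤ))))
thin-four (base {a} _ _) (base {b} _ _) apex (base {d} _ _) = inj₂ (inj₁ (turn-bases a b d))

thin-points : ∀ {l} φ vs → 1ℚ ≤ l → image (apply φ) (conv (map fromℤ² vs)) ⊆ thinTriangle l → ∀ i → ThinPoint l (applyℤ φ (lookup vs i))
thin-points {l} φ vs 1≤l S⊆T i = point (applyℤ φ (lookup vs i)) (vertex-image φ vs {thinTriangle l} S⊆T i)
  where
  0<l : 0ℚ < l
  0<l = <-≤-trans (from-yes (0ℚ <? 1ℚ)) 1≤l
  0≤l : 0ℚ ≤ l
  0≤l = <⇒≤ 0<l
  vanish : ∀ l → 0ℚ ≡ - 1ℚ * l + - l * 0ℚ + l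
  vanish = solve-∀ ℚ-ring
  vanish′ : ∀ l → 0ℚ ≡ - 1ℚ * 0ℚ + - l * 1ℚ + l
  vanish′ = solve-∀ ℚ-ring
  slack : ∀ l → l ≡ - 1ℚ * 0ℚ + - l * 0ℚ + l
  slack = solve-∀ ℚ-ring
  pick-x : ∀ x y → 1ℚ * x + 0ℚ * y + 0ℚ ≡ x
  pick-x = solve-∀ ℚ-ring
  pick-y : ∀ x y → 0ℚ * x + 1ℚ * y + 0ℚ ≡ y
  pick-y = solve-∀ ℚ-ring
  edge : ∀ l x y → - 1ℚ * x + - l * y + l ≡ l - (x + l * y)
  edge = solve-∀ ℚ-ring
  point : ∀ v → thinTriangle l (fromℤ² v) → ThinPoint l v
  point (x , y) t = classify-y (bit (fromℤ-cancel-≤ 0≤y) (fromℤ-cancel-≤ y≤1)) refl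
    where
    u v : ℚ
    u = fromℤ x
    v = fromℤ y
    0≤x : 0ℚ ≤ u
    0≤x = subst (0ℚ ≤_) (pick-x u v) (conv-half-plane 1ℚ 0ℚ 0ℚ
      (≤-refl ∷ subst (0ℚ ≤_) (sym (pick-x l 0ℚ)) 0≤l ∷ ≤-refl ∷ []) t)
    0≤y : 0ℚ ≤ v
    0≤y = subst (0ℚ ≤_) (pick-y u v) (conv-half-plane 0ℚ 1ℚ 0ℚ
      (≤-refl ∷ ≤-reflexive (sym (pick-y l 0ℚ)) ∷ from-yes (0ℚ ≤? 1ℚ) ∷ []) t)
    x+ly≤l : u + l * v ≤ l
    x+ly≤l = 0≤q-p⇒p≤q (subst (0ℚ ≤_) (edge l u v) (conv-half-plane (- 1ℚ) (- l) l
      (subst (0ℚ ≤_) (slack l) 0≤l ∷ ≤-reflexive (vanish l) ∷ ≤-reflexive (vanish′ l) ∷ []) t))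
    y≤1 : v ≤ 1ℚ
    y≤1 = *-cancelˡ-≤-pos l {{positive 0<l}} (≤-trans (subst (_≤ u + l * v) (+-identityˡ (l * v)) (+-monoˡ-≤ (l * v) 0≤x))
      (≤-trans x+ly≤l (≤-reflexive (sym (*-identityʳ l)))))
    classify-y : ∀ {z} → Bit z → y ≡ z → ThinPoint l (x , y)
    classify-y O refl = base (fromℤ-cancel-≤ 0≤x) (subst (_≤ l) (trans (cong (_+_ u) (*-zeroʳ l)) (+-identityʳ u)) x+ly≤l)
    classify-y I refl = subst (λ z → ThinPoint l (z , 1ℤ)) (sym x≡0) apex
      where
      -- At height one, x + l y ≤ l leaves x ≤ 0.
      x≡0 : x ≡ 0ℤ
      x≡0 = ℤ.≤-antisym (fromℤ-cancel-≤ (0≤q-p⇒p≤q (subst (0ℚ ≤_) (go l u) (p≤q⇒0≤q-p x+ly≤l)))) (fromℤ-cancel-≤ 0≤x)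
        where
        go : ∀ l u → l - (u + l * 1ℚ) ≡ 0ℚ - u
        go = solve-∀ ℚ-ring

thin-twiceArea : ∀ {l} vs → TurnsLeft vs → 1ℚ ≤ l → conv (map fromℤ² vs) ≃ₗ thinTriangle l → fromℤ (twiceArea vs) ≤ l
thin-twiceArea {l} vs ccw 1≤l (φ , S⊆T , _) = go vs ccw (thin-points φ vs 1≤l S⊆T)
  where
  0≤l : 0ℚ ≤ l
  0≤l = ≤-trans (from-yes (0ℚ ≤? 1ℚ)) 1≤l
  go : ∀ vs → TurnsLeft vs → (∀ i → ThinPoint l (applyℤ φ (lookup vs i))) → fromℤ (twiceArea vs) ≤ l
  go [] ccw h = 0≤l
  go (o ∷ []) ccw h = subst (λ D → fromℤ D ≤ l) (sym (twiceArea-fan o [])) 0≤l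
  go (o ∷ p ∷ []) ccw h = subst (λ D → fromℤ D ≤ l) (sym (twiceArea-fan o (p ∷ []))) 0≤l
  go (o ∷ p ∷ q ∷ []) ccw h = subst (λ D → fromℤ D ≤ l) (sym (trans (twiceArea-fan o (p ∷ q ∷ [])) (ℤ.+-identityʳ (turn o p q))))
    ([ (λ eq → subst (λ t → fromℤ t ≤ l) (sym eq) (thin-turn 0≤l (h 0F) (h 1F) (h 2F)))
     , (λ eq → subst (λ t → fromℤ t ≤ l) (sym eq) (thin-turn 0≤l (h 0F) (h 2F) (h 1F))) ]′ (turn-preimage φ o p q))
  go (_ ∷ _ ∷ _ ∷ _ ∷ _) ccw h = contradiction (thin-four (h 0F) (h 1F) (h 2F) (h 3F))
    [ image-turn≢0 φ ccw {0F} {1F} {2F} z<s (s<s z<s)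
    , [ image-turn≢0 φ ccw {0F} {1F} {3F} z<s (s<s z<s)
      , [ image-turn≢0 φ ccw {0F} {2F} {3F} z<s (s<s (s<s z<s))
        , image-turn≢0 φ ccw {1F} {2F} {3F} (s<s z<s) (s<s (s<s z<s)) ]′ ]′ ]′

mainTheorem4 : (P : LatticePolygon) (l : ℚ) →
    area P ≢ 0ℚ →
    IsLsΔ (region P) l →
    (½ * l ≤ area P) ×
    (area P ≡ ½ * l ⇔
    ((1ℚ ≤ l × region P ≃ₗ thinTriangle l) ⊎
    (l ≡ 2ℚ × region P ≃ₗ unitSquare) ⊎
    (l ≡ 3ℚ × region P ≃ₗ triangle₁₂)))
mainTheorem4 P l area≢0 ls = lower , mk⇔ shape converse
  where
  open LatticePolygon P using (vertices; ccw)
  D : ℤ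
  D = twiceArea vertices
  out : Outcome (lookup vertices) D
  out = outcome vertices ccw (λ D≡0 → area≢0 (cong (λ t → ½ * fromℤ t) D≡0))
  lower : ½ * l ≤ ½ * fromℤ D
  lower = *-monoˡ-≤-nonNeg ½ (ls≤twiceArea {vertices} out ls)
  -- Given `lower`, equality for an exceptional shape only requires bounding twice the area by l
  -- from above.
  upper : fromℤ D ≤ l → ½ * fromℤ D ≡ ½ * l
  upper h = ≤-antisym (*-monoˡ-≤-nonNeg ½ h) lower
  shape : ½ * fromℤ D ≡ ½ * l → _
  shape eq = optimal-shape {vertices} out ls (trans (sym (double l)) (trans (cong (_*_ 2ℚ) (sym eq)) (double (fromℤ D))))
    where
    double : ∀ x → 2ℚ * (½ * x) ≡ x
    double = solve-∀ ℚ-ring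
  converse : (1ℚ ≤ l × region P ≃ₗ thinTriangle l) ⊎ (l ≡ 2ℚ × region P ≃ₗ unitSquare) ⊎ (l ≡ 3ℚ × region P ≃ₗ triangle₁₂) →
             ½ * fromℤ D ≡ ½ * l
  converse (inj₁ (1≤l , eq)) = upper (thin-twiceArea vertices ccw 1≤l eq)
  converse (inj₂ (inj₁ (refl , eq))) = upper (square-twiceArea vertices ccw eq)
  converse (inj₂ (inj₂ (refl , eq))) = upper (triangle-twiceArea vertices ccw eq)
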